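{- For $n\geq1$, $$\sum_{\pi\in\mathfrak{S}_n(3142,3124)}s^{\mathrm{VID}(\pi)}t^{\mathrm{DES}(\pi)}=\sum_{e\in\mathbf{I}_n(\geq,\neq,\geq)}s^{\mathrm{DIST}(e)}t^{\mathrm{ASC}(e)}.$$
   Context: $\mathfrak{S}_n(3142,3124)$ is the set of permutations of $\{1,\ldots,n\}$ containing no subsequence of length 4 order-isomorphic to $3142$ or $3124$. $\mathrm{DES}(\pi)=\{i\in[n-1]:\pi_i>\pi_{i+1}\}$; $\mathrm{VID}(\pi)=\{2\leq i\leq n:\text{the value } \pi_i+1 \text{ appears to the left of position } i\}$. $\mathbf{I}_n=\{(e_1,\ldots,e_n): 0\leq e_i<i\}$; $\mathbf{I}_n(\geq,\neq,\geq)$ is the set of $e\in\mathbf{I}_n$ with no $i<j<k$ such that $e_i\geq e_j$, $e_j\neq e_k$ and $e_i\geq e_k$. $\mathrm{ASC}(e)=\{i\in[n-1]:e_i<e_{i+1}\}$; $\mathrm{DIST}(e)=\{2\leq i\leq n: e_i\neq0\text{ and } e_i\neq e_j\text{ for all } j>i\}$. For a set $S$ of positive integers, $s^S=\prod_{i\in S}s_i$, $t^S=\prod_{i\in S}t_i$. -}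

module Defs where

open import Data.Nat.Base using (ℕ; zero; suc; _∸_; _<ᵇ_; _≡ᵇ_; _≤ᵇ_)
open import Data.Bool.Base using (Bool; true; false; _∧_; _∨_; not; if_then_else_)
open import Data.List.Base using (List; []; _∷_; map; concatMap; filterᵇ; foldr)
open import Data.Bool.ListAction using (any; all)
open import Level using (Level)
open import Algebra.Bundles using (CommutativeSemiring)

-- Conventions: a sequence (permutation or inversion sequence) of length n is a
-- List ℕ; positions are 1-indexed.  Out-of-range lookups return 0 (never used).

range : ℕ → ℕ → List ℕ
range a b = go a (suc b ∸ a)
  where
  go : ℕ → ℕ → List ℕ
  go x zero    = []
  go x (suc k) = x ∷ go (suc x) k

at : List ℕ → ℕ → ℕ
at []       _             = 0
at (x ∷ xs) zero          = 0
at (x ∷ xs) (suc zero)    = x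
at (x ∷ xs) (suc (suc i)) = at xs (suc i)

_≠ᵇ_ : ℕ → ℕ → Bool
a ≠ᵇ b = not (a ≡ᵇ b)

words : ℕ → ℕ → List (List ℕ)
words zero    k = [] ∷ []
words (suc n) k = concatMap (λ w → map (λ a → a ∷ w) (range 1 k)) (words n k)

-- a word of length n over {1..n} is a permutation iff every value 1..n occurs
isPerm : ℕ → List ℕ → Bool
isPerm n w = all (λ v → any (λ x → x ≡ᵇ v) w) (range 1 n)

perms : ℕ → List (List ℕ)
perms n = filterᵇ (isPerm n) (words n n)

contains3142 : ℕ → List ℕ → Bool
contains3142 n π =
  any (λ i → any (λ j → any (λ k → any (λ l →
    (at π j <ᵇ at π l) ∧ (at π l <ᵇ at π i) ∧ (at π i <ᵇ at π k))
    (range (suc k) n)) (range (suc j) n)) (range (suc i) n)) (range 1 n)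

contains3124 : ℕ → List ℕ → Bool
contains3124 n π =
  any (λ i → any (λ j → any (λ k → any (λ l →
    (at π j <ᵇ at π k) ∧ (at π k <ᵇ at π i) ∧ (at π i <ᵇ at π l))
    (range (suc k) n)) (range (suc j) n)) (range (suc i) n)) (range 1 n)

avoiders : ℕ → List (List ℕ)
avoiders n = filterᵇ (λ π → not (contains3142 n π ∨ contains3124 n π)) (perms n)

DES : ℕ → List ℕ → List ℕ
DES n π = filterᵇ (λ i → at π (suc i) <ᵇ at π i) (range 1 (n ∸ 1))

VID : ℕ → List ℕ → List ℕ
VID n π = filterᵇ (λ i → any (λ j → at π j ≡ᵇ suc (at π i)) (range 1 (i ∸ 1))) (range 2 n)

invSeqs : ℕ → List (List ℕ)
invSeqs zero    = [] ∷ []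
invSeqs (suc n) = concatMap (λ e → map (λ a → snoc e a) (range 0 n)) (invSeqs n)
  where
  snoc : List ℕ → ℕ → List ℕ
  snoc []       a = a ∷ []
  snoc (x ∷ xs) a = x ∷ snoc xs a

containsGeNeGe : ℕ → List ℕ → Bool
containsGeNeGe n e =
  any (λ i → any (λ j → any (λ k →
    (at e j ≤ᵇ at e i) ∧ (at e j ≠ᵇ at e k) ∧ (at e k ≤ᵇ at e i))
    (range (suc j) n)) (range (suc i) n)) (range 1 n)

invAvoiders : ℕ → List (List ℕ)
invAvoiders n = filterᵇ (λ e → not (containsGeNeGe n e)) (invSeqs n)

ASC : ℕ → List ℕ → List ℕ
ASC n e = filterᵇ (λ i → at e i <ᵇ at e (suc i)) (range 1 (n ∸ 1))

DIST : ℕ → List ℕ → List ℕ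
DIST n e = filterᵇ (λ i → (at e i ≠ᵇ 0) ∧ all (λ j → at e i ≠ᵇ at e j) (range (suc i) n)) (range 2 n)

-- Generating-function sums, evaluated in an arbitrary commutative semiring
-- at arbitrary values of the variables s_i, t_i.

module _ {c ℓ : Level} (R : CommutativeSemiring c ℓ) where
  open CommutativeSemiring R

  monomial : (ℕ → Carrier) → List ℕ → Carrier
  monomial x S = foldr (λ i acc → x i * acc) 1# S

  Σ[_] : {A : Set} → List A → (A → Carrier) → Carrier
  Σ[ xs ] f = foldr (λ a acc → f a + acc) 0# xs

{-# OPTIONS --safe #-}
-- Read both objects from left to right and remember what is still to come.  For an inversion sequence
-- this is the set of values at most i that occur after position i (the labels, in increasing order);
-- for a permutation it is the set of unused values, cut into maximal intervals (the runs, from the top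
-- down).  A letter picks a label or a run by its rank.  A label disappears at its last occurrence and a
-- run loses its top exactly at a VID position (the label 0 and the value n excepted), so DIST
-- corresponds to VID; ASC and DES both compare the ranks of consecutive letters.  Avoiding (≥,≠,≥), respectively 3142 and 3124, means in both cases
-- that after each letter at most one label (run) of rank up to its own remains.  So only ranks 0 and 1
-- occur, the latter only with removal, and both sums obey the same recursion `pathSum` in the number of
-- labels (runs); on the permutation side this holds after summing over all run sizes.
module Submission where

open import Defs
open import Level using (Level)
open import Data.Bool.Base using (Bool; true; false; T; not; _∧_; _∨_; if_then_else_)
open import Data.Bool.ListAction using (any; all)
open import Data.Bool.Properties using (T-≡; T-∧; T-∨)
open import Data.Empty using (⊥; ⊥-elim)
open import Data.List.Base using (List; []; _∷_; _∷ʳ_; [_]; _++_; map; concatMap; filterᵇ; iterate; length)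
open import Data.List.Properties using (map-cong; concatMap-cong; length-++; ++-assoc)
open import Data.List.Membership.Propositional using (_∈_; _∉_; lose; find)
open import Data.List.Membership.Propositional.Properties using (∈-++⁻; ∈-++⁺ˡ; ∈-++⁺ʳ; ∈-∃++)
open import Data.List.Relation.Unary.All as All using (All; []; _∷_)
import Data.List.Relation.Unary.All.Properties as Allₚ
open import Data.List.Relation.Unary.AllPairs as AllPairs using (AllPairs; []; _∷_)
import Data.List.Relation.Unary.AllPairs.Properties as AllPairsₚ
open import Data.List.Relation.Unary.Any using (Any; here; there)
open import Data.List.Relation.Unary.Any.Properties using (any⁺; any⁻)
open import Data.List.Relation.Unary.Unique.Propositional using (Unique)
open import Data.Nat.Base using (ℕ; zero; suc; _+_; _∸_; _≤_; _<_; z≤n; s≤s; _≡ᵇ_; _<ᵇ_; _≤ᵇ_)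
open import Data.Nat.Properties as ℕ using (_≟_; _<?_; ≡⇒≡ᵇ; ≡ᵇ⇒≡; <⇒<ᵇ; <ᵇ⇒<; ≤⇒≤ᵇ; ≤ᵇ⇒≤; ≤-refl; ≤-trans; <⇒≤; >⇒≢; ≤⇒≯; ≤∧≢⇒<; m≤n⇒m≤1+n; m<m+n; m+[n∸m]≡n; +-suc)
open import Data.List.Membership.DecPropositional _≟_ using (_∈?_)
open import Data.Product.Base using (_×_; _,_; ∃; ∃₂; proj₁; proj₂)
open import Data.Sum.Base using (_⊎_; inj₁; inj₂; [_,_]′)
open import Data.Unit.Base using (⊤; tt)
open import Algebra.Bundles using (CommutativeSemiring)
import Algebra.Properties.CommutativeSemigroup as CSemigroup
open import Function.Base using (_∘_)
open import Function.Bundles using (Equivalence)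
open import Relation.Binary.Definitions using (tri<; tri≈; tri>)
open import Relation.Binary.PropositionalEquality as ≡ using (_≡_; _≢_)
import Relation.Binary.Reasoning.Setoid as SetoidReasoning
open import Relation.Nullary using (¬_; contradiction; yes; no; Dec; does; ¬?; _×-dec_)
open import Relation.Nullary.Decidable using (dec-true; dec-false)

-- No bijection is built. The obstacle is that the number of labels or runs alone does not determine
-- the continuations. For an inversion sequence, after i + 1 letters the value i + 1 becomes legal,
-- and nothing read so far tells whether it will be used. The automaton `Φ` therefore tries both
-- answers, and a wrong one contributes 0. For a permutation, a letter breaks its run, and the
-- number of runs left depends on whether the piece below the letter is empty. This is governed by
-- the run sizes, which the recursion must not see. Summed over all compositions of the remaining
-- total into k parts, both cases occur freely, and "empty or not" plays the role of the guess "i +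
-- 1 returns or not". Ranks are bounded because a letter of rank 2 or more leaves two labels (runs)
-- of smaller rank behind, while a letter of rank 1 leaves the one of rank 0 and so must use up its
-- own: its last occurrence, respectively the top of its run.

-- Sums over antidiagonals and compositions

module Compositions {c ℓ : Level} (R : CommutativeSemiring c ℓ) where
  open CommutativeSemiring R hiding (zero) renaming (_+_ to _⊕_; _*_ to _⊗_)
  open SetoidReasoning setoid
  open CSemigroup +-commutativeSemigroup using (interchange)

  antidiag : ℕ → (ℕ → ℕ → Carrier) → Carrier
  antidiag zero    g = g 0 0
  antidiag (suc m) g = g 0 (suc m) ⊕ antidiag m (g ∘ suc)

  antidiag-cong : ∀ m {g h} → (∀ a b → g a b ≈ h a b) → antidiag m g ≈ antidiag m h
  antidiag-cong zero    g≈h = g≈h 0 0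
  antidiag-cong (suc m) g≈h = +-cong (g≈h 0 (suc m)) (antidiag-cong m (g≈h ∘ suc))

  antidiag-cong-≡ : ∀ m {g h} → (∀ a b → a + b ≡ m → g a b ≈ h a b) → antidiag m g ≈ antidiag m h
  antidiag-cong-≡ zero    g≈h = g≈h 0 0 ≡.refl
  antidiag-cong-≡ (suc m) g≈h =
    +-cong (g≈h 0 (suc m) ≡.refl) (antidiag-cong-≡ m (λ a b eq → g≈h (suc a) b (≡.cong suc eq)))

  antidiag-+ : ∀ m g h → antidiag m (λ a b → g a b ⊕ h a b) ≈ antidiag m g ⊕ antidiag m h
  antidiag-+ zero    g h = refl
  antidiag-+ (suc m) g h = trans (+-congˡ (antidiag-+ m _ _)) (interchange _ _ _ _)

  antidiag-* : ∀ m x g → antidiag m (λ a b → x ⊗ g a b) ≈ x ⊗ antidiag m g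
  antidiag-* zero    x g = refl
  antidiag-* (suc m) x g = trans (+-congˡ (antidiag-* m x _)) (sym (distribˡ _ _ _))

  antidiag-0 : ∀ m {g} → (∀ a b → g a b ≈ 0#) → antidiag m g ≈ 0#
  antidiag-0 zero    g≈0 = g≈0 0 0
  antidiag-0 (suc m) g≈0 = trans (+-cong (g≈0 0 (suc m)) (antidiag-0 m (g≈0 ∘ suc))) (+-identityˡ 0#)

  antidiag-last : ∀ m g → antidiag (suc m) g ≈ antidiag m (λ a b → g a (suc b)) ⊕ g (suc m) 0
  antidiag-last zero    g = refl
  antidiag-last (suc m) g = trans (+-congˡ (antidiag-last m (g ∘ suc))) (sym (+-assoc _ _ _))

  -- Both sides run over the triples with a + b + y = m, grouped from the left or from the right.
  antidiag-assoc : ∀ m (g : ℕ → ℕ → ℕ → Carrier) →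
    antidiag m (λ x y → antidiag x (λ a b → g a b y)) ≈ antidiag m (λ a x → antidiag x (g a))
  antidiag-assoc zero    g = refl
  antidiag-assoc (suc m) g = begin
    g 0 0 (suc m) ⊕ antidiag m (λ x y → g 0 (suc x) y ⊕ antidiag x (λ a b → g (suc a) b y))
      ≈⟨ +-congˡ (antidiag-+ m _ _) ⟩
    g 0 0 (suc m) ⊕ (antidiag m (g 0 ∘ suc) ⊕ antidiag m (λ x y → antidiag x (λ a b → g (suc a) b y)))
      ≈⟨ +-assoc _ _ _ ⟨
    antidiag (suc m) (g 0) ⊕ antidiag m (λ x y → antidiag x (λ a b → g (suc a) b y))
      ≈⟨ +-congˡ (antidiag-assoc m (g ∘ suc)) ⟩
    antidiag (suc m) (g 0) ⊕ antidiag m (λ a x → antidiag x (g (suc a))) ∎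

  -- Sum over the compositions of m into k positive parts; a part p is stored as p - 1.
  compositions : ℕ → ℕ → (List ℕ → Carrier) → Carrier
  compositions zero    zero    f = f []
  compositions zero    (suc m) f = 0#
  compositions (suc k) zero    f = 0#
  compositions (suc k) (suc m) f = antidiag m (λ a y → compositions k y (f ∘ (a ∷_)))

  compositions-cong : ∀ k m {f g} → (∀ cs → f cs ≈ g cs) → compositions k m f ≈ compositions k m g
  compositions-cong zero    zero    f≈g = f≈g []
  compositions-cong zero    (suc m) f≈g = refl
  compositions-cong (suc k) zero    f≈g = refl
  compositions-cong (suc k) (suc m) f≈g =
    antidiag-cong m (λ a y → compositions-cong k y (f≈g ∘ (a ∷_)))

  compositions-+ : ∀ k m f g →
    compositions k m (λ cs → f cs ⊕ g cs) ≈ compositions k m f ⊕ compositions k m g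
  compositions-+ zero    zero    f g = refl
  compositions-+ zero    (suc m) f g = sym (+-identityˡ 0#)
  compositions-+ (suc k) zero    f g = sym (+-identityˡ 0#)
  compositions-+ (suc k) (suc m) f g =
    trans (antidiag-cong m (λ a y → compositions-+ k y _ _)) (antidiag-+ m _ _)

  compositions-* : ∀ k m x f → compositions k m (λ cs → x ⊗ f cs) ≈ x ⊗ compositions k m f
  compositions-* zero    zero    x f = refl
  compositions-* zero    (suc m) x f = sym (zeroʳ x)
  compositions-* (suc k) zero    x f = sym (zeroʳ x)
  compositions-* (suc k) (suc m) x f =
    trans (antidiag-cong m (λ a y → compositions-* k y x _)) (antidiag-* m x _)

  compositions-antidiag : ∀ k m c (g : ℕ → ℕ → List ℕ → Carrier) →
    compositions k m (λ cs → antidiag c (λ a b → g a b cs)) ≈ antidiag c (λ a b → compositions k m (g a b))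
  compositions-antidiag k m zero    g = refl
  compositions-antidiag k m (suc c) g =
    trans (compositions-+ k m _ _) (+-congˡ (compositions-antidiag k m c (g ∘ suc)))

  compositions-singleton : ∀ m f → compositions 1 (suc m) f ≈ f (m ∷ [])
  compositions-singleton zero    f = refl
  -- A first part below the total leaves a remainder without parts, hence 0. Peeling it off shifts
  -- the single part by one; the clause for `[]` is a dummy value.
  compositions-singleton (suc m) f =
    trans (+-identityˡ _) (compositions-singleton m (λ { [] → f [] ; (c ∷ cs) → f (suc c ∷ cs) }))

  -- A leading part of true size a, possibly empty: the empty one disappears and is treated by `f`,
  -- any other is stored minus one and treated by `g`.
  ifZero : (f g : List ℕ → Carrier) → ℕ → List ℕ → Carrier
  ifZero f g zero    cs = f cs
  ifZero f g (suc a) cs = g (a ∷ cs)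

  onCons : (ℕ → List ℕ → Carrier) → List ℕ → Carrier
  onCons f []       = 0#
  onCons f (a ∷ cs) = f a cs

  compositions-ifZero : ∀ k m f g →
    antidiag m (λ a y → compositions k y (ifZero f g a)) ≈ compositions k m f ⊕ compositions (suc k) m g
  compositions-ifZero k zero    f g = sym (+-identityʳ _)
  compositions-ifZero k (suc m) f g = refl

consPart : ℕ → List ℕ → List ℕ
consPart zero    cs = cs
consPart (suc a) cs = a ∷ cs

-- The common recursion, with and without run sizes

module Transfer {c ℓ : Level} (R : CommutativeSemiring c ℓ)
                (s t : ℕ → CommutativeSemiring.Carrier R) where
  open CommutativeSemiring R hiding (zero) renaming (_+_ to _⊕_; _*_ to _⊗_)
  open SetoidReasoning setoid
  open CSemigroup +-commutativeSemigroup using (interchange)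
  open Compositions R

  tWeight : Bool → ℕ → Carrier
  tWeight true  i = 1#
  tWeight false i = t i

  sWeight : Bool → ℕ → Carrier
  sWeight true  i = 1#
  sWeight false i = s i

  -- m letters remain, i have been read and k labels (runs) are available.  The flag z records that the
  -- label 0 (the run containing the largest value) is still available, and d that the previous letter
  -- lies at or above the first label (below the first run), so that rank 0 is no ascent (descent).
  pathSum : (m i k : ℕ) (z d : Bool) → Carrier
  secondRank : (m i k : ℕ) (z : Bool) → Carrier
  pathSum zero    i zero    z d = 1#
  pathSum zero    i (suc k) z d = 0#
  pathSum (suc m) i zero    z d = 0#
  pathSum (suc m) i (suc k) z d =
    -- Rank 0. In the first pair the label (run) survives the letter, in the second it is used up;
    -- within each pair the alternative is whether a new label (a lower piece of the run) appears.
    -- Using it up leaves everything else beyond the letter, so the next letter of rank 0 is an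
    -- ascent (descent).
    tWeight d i ⊗ ((pathSum m (suc i) (suc k) z true ⊕ pathSum m (suc i) (suc (suc k)) z true)
                   ⊕ sWeight z (suc i) ⊗ (pathSum m (suc i) k false false ⊕ pathSum m (suc i) (suc k) false false))
    ⊕ secondRank m i k z

  secondRank m i zero      z = 0#
  -- Here k does not count the label (run) of rank 0. That one survives, so z persists and d becomes
  -- true; the letter itself is an ascent (descent) whatever came before.
  secondRank m i k@(suc _) z = (t i ⊗ s (suc i)) ⊗ (pathSum m (suc i) k z true ⊕ pathSum m (suc i) (suc k) z true)

  -- The same recursion with the run sizes recorded (each minus one).
  sizesSum : (m i : ℕ) (z : Bool) (cs : List ℕ) (d : Bool) → Carrier
  sizesSum zero    i z []       d = 1#
  sizesSum zero    i z (_ ∷ _)  d = 0#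
  sizesSum (suc m) i z []       d = 0#
  sizesSum (suc m) i z (x ∷ cs) d =
    tWeight d i ⊗ antidiag x (λ a b → ifZero (λ ds → sWeight z (suc i) ⊗ sizesSum m (suc i) false ds false)
                                             (λ ds → sizesSum m (suc i) z ds true) a (consPart b cs))
    ⊕ onCons (λ y ds → (t i ⊗ s (suc i)) ⊗ sizesSum m (suc i) z (x ∷ consPart y ds) true) cs

  compositions-consPart : ∀ k m f →
    antidiag m (λ b y → compositions k y (λ cs → f (consPart b cs))) ≈ compositions k m f ⊕ compositions (suc k) m f
  compositions-consPart k m f = trans
    (antidiag-cong m (λ { zero y → refl ; (suc b) y → refl }))
    (compositions-ifZero k m f f)

  -- The second part loses one element and the true size b that remains may be 0, so k + 1 or k + 2
  -- parts with total m are left.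
  compositions-second : ∀ k m f →
    antidiag m (λ x y → compositions (suc k) y (onCons (λ b cs → f (x ∷ consPart b cs))))
    ≈ compositions (suc k) m f ⊕ compositions (suc (suc k)) m f
  compositions-second k zero    f = sym (+-identityʳ 0#)
  compositions-second k (suc m) f = begin
    antidiag (suc m) (λ x y → compositions (suc k) y (onCons (λ b cs → f (x ∷ consPart b cs))))
      -- The term with nothing beyond the first part is 0, since it has no second part.
      ≈⟨ antidiag-last m (λ x y → compositions (suc k) y (onCons (λ b cs → f (x ∷ consPart b cs)))) ⟩
    antidiag m (λ x y → antidiag y (λ b y′ → compositions k y′ (λ cs → f (x ∷ consPart b cs)))) ⊕ 0#
      ≈⟨ +-identityʳ _ ⟩
    antidiag m (λ x y → antidiag y (λ b y′ → compositions k y′ (λ cs → f (x ∷ consPart b cs))))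
      ≈⟨ antidiag-cong m (λ x y → compositions-consPart k y (f ∘ (x ∷_))) ⟩
    antidiag m (λ x y → compositions k y (f ∘ (x ∷_)) ⊕ compositions (suc k) y (f ∘ (x ∷_)))
      ≈⟨ antidiag-+ m _ _ ⟩
    compositions (suc k) (suc m) f ⊕ compositions (suc (suc k)) (suc m) f ∎

  -- The first part of size x + 1 breaks into a elements above and b below the removed one.
  -- Regrouping (a + b) + y as a + (b + y) makes a and b independent, possibly empty parts, which
  -- gives the four terms.
  compositions-first : ∀ k m (f g : List ℕ → Carrier) →
    compositions (suc k) (suc m) (onCons (λ x cs → antidiag x (λ a b → ifZero f g a (consPart b cs))))
    ≈ (compositions (suc k) m g ⊕ compositions (suc (suc k)) m g) ⊕ (compositions k m f ⊕ compositions (suc k) m f)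
  compositions-first k m f g = begin
    antidiag m (λ x y → compositions k y (λ cs → antidiag x (λ a b → ifZero f g a (consPart b cs))))
      ≈⟨ antidiag-cong m (λ x y → compositions-antidiag k y x _) ⟩
    antidiag m (λ x y → antidiag x (λ a b → compositions k y (λ cs → ifZero f g a (consPart b cs))))
      ≈⟨ antidiag-assoc m (λ a b y → compositions k y (λ cs → ifZero f g a (consPart b cs))) ⟩
    antidiag m (λ a x → antidiag x (λ b y → compositions k y (λ cs → ifZero f g a (consPart b cs))))
      ≈⟨ antidiag-cong m (λ a x → compositions-consPart k x (ifZero f g a)) ⟩
    antidiag m (λ a x → compositions k x (ifZero f g a) ⊕ compositions (suc k) x (ifZero f g a))
      ≈⟨ antidiag-+ m _ _ ⟩
    antidiag m (λ a x → compositions k x (ifZero f g a)) ⊕ antidiag m (λ a x → compositions (suc k) x (ifZero f g a))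
      ≈⟨ +-cong (compositions-ifZero k m f g) (compositions-ifZero (suc k) m f g) ⟩
    (compositions k m f ⊕ compositions (suc k) m g) ⊕ (compositions (suc k) m f ⊕ compositions (suc (suc k)) m g)
      ≈⟨ interchange _ _ _ _ ⟩
    (compositions k m f ⊕ compositions (suc k) m f) ⊕ (compositions (suc k) m g ⊕ compositions (suc (suc k)) m g)
      ≈⟨ +-comm _ _ ⟩
    (compositions (suc k) m g ⊕ compositions (suc (suc k)) m g) ⊕ (compositions k m f ⊕ compositions (suc k) m f) ∎

  -- The sum over all sizes closes the recursion: each move leads from all compositions into k parts
  -- to all compositions into a neighbouring number of parts, so only the number of parts matters.
  compositions-sizesSum : ∀ m i k z d → compositions k m (λ cs → sizesSum m i z cs d) ≈ pathSum m i k z d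
  compositions-sizesSum zero    i zero    z d = refl
  compositions-sizesSum zero    i (suc k) z d = refl
  compositions-sizesSum (suc m) i zero    z d = refl
  compositions-sizesSum (suc m) i (suc k) z d = begin
    compositions (suc k) (suc m) (λ cs → sizesSum (suc m) i z cs d)
      ≈⟨ antidiag-cong m (λ x y → compositions-+ k y _ _) ⟩
    antidiag m (λ x y → compositions k y (λ cs → tWeight d i ⊗ antidiag x (λ a b → ifZero f g a (consPart b cs))) ⊕ _)
      ≈⟨ antidiag-+ m _ _ ⟩
    _ ≈⟨ +-cong
          (begin
            antidiag m (λ x y → compositions k y (λ cs → tWeight d i ⊗ antidiag x (λ a b → ifZero f g a (consPart b cs))))
              ≈⟨ antidiag-cong m (λ x y → compositions-* k y _ _) ⟩
            _ ≈⟨ antidiag-* m _ _ ⟩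
            _ ≈⟨ *-congˡ (compositions-first k m f g) ⟩
            tWeight d i ⊗ ((compositions (suc k) m g ⊕ compositions (suc (suc k)) m g)
                           ⊕ (compositions k m f ⊕ compositions (suc k) m f))
              ≈⟨ *-congˡ (+-cong (+-cong (compositions-sizesSum m (suc i) (suc k) z true)
                                         (compositions-sizesSum m (suc i) (suc (suc k)) z true))
                    (trans (+-cong (trans (compositions-* k m _ _) (*-congˡ (compositions-sizesSum m (suc i) k false false)))
                                   (trans (compositions-* (suc k) m _ _) (*-congˡ (compositions-sizesSum m (suc i) (suc k) false false))))
                           (sym (distribˡ _ _ _)))) ⟩
            _ ∎)
          (second k) ⟩
    pathSum (suc m) i (suc k) z d ∎
    where
    f g : List ℕ → Carrier
    f ds = sWeight z (suc i) ⊗ sizesSum m (suc i) false ds false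
    g ds = sizesSum m (suc i) z ds true

    second : ∀ k → antidiag m (λ x y → compositions k y
      (onCons (λ b ds → (t i ⊗ s (suc i)) ⊗ g (x ∷ consPart b ds)))) ≈ secondRank m i k z
    second zero    = antidiag-0 m (λ { x zero → refl ; x (suc y) → refl })
    second (suc k) = begin
      _ ≈⟨ antidiag-cong m (λ x y → compositions-cong (suc k) y
             (λ { [] → sym (zeroʳ _) ; (_ ∷ _) → refl })) ⟩
      _ ≈⟨ antidiag-cong m (λ x y → compositions-* (suc k) y _ _) ⟩
      _ ≈⟨ antidiag-* m (t i ⊗ s (suc i)) _ ⟩
      _ ≈⟨ *-congˡ (compositions-second k m g) ⟩
      _ ≈⟨ *-congˡ (+-cong (compositions-sizesSum m (suc i) (suc k) z true) (compositions-sizesSum m (suc i) (suc (suc k)) z true)) ⟩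
      _ ∎

-- Ranges and inversion sequences read from the front

≡ᵇ-refl : ∀ m → (m ≡ᵇ m) ≡ true
≡ᵇ-refl m = Equivalence.to T-≡ (≡⇒≡ᵇ m m ≡.refl)

≢⇒≡ᵇ-false : ∀ {m n} → m ≢ n → (m ≡ᵇ n) ≡ false
≢⇒≡ᵇ-false {m} {n} m≢n with m ≡ᵇ n in eq
... | false = ≡.refl
... | true  = contradiction (≡ᵇ⇒≡ m n (Equivalence.from T-≡ eq)) m≢n

-- `range` and `invSeqs` are defined through local functions that cannot be named here: the first is
-- recovered by unification (the `_` in the type of `go≡iterate`), the second from its defining equations.
mutual
  range≡iterate : ∀ a b → range a b ≡ iterate suc a (suc b ∸ a)
  range≡iterate a b with suc b ∸ a
  ... | zero  = ≡.refl
  ... | suc k with suc a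
  ...   | x = ≡.cong (a ∷_) (go≡iterate a b x k)

  go≡iterate : ∀ a b x k → _ ≡ iterate suc x k
  go≡iterate a b x zero    = ≡.refl
  go≡iterate a b x (suc k) = ≡.cong (x ∷_) (go≡iterate a b (suc x) k)

concatMap-snoc : (snoc : List ℕ → ℕ → List ℕ) → (∀ a → snoc [] a ≡ [ a ]) →
  (∀ x xs a → snoc (x ∷ xs) a ≡ x ∷ snoc xs a) →
  ∀ as es → concatMap (λ e → map (λ a → snoc e a) as) es ≡ concatMap (λ e → map (e ∷ʳ_) as) es
concatMap-snoc snoc eq₀ eq₁ as = concatMap-cong (λ e → map-cong (snoc≡∷ʳ e) as)
  where
  snoc≡∷ʳ : ∀ xs a → snoc xs a ≡ xs ∷ʳ a
  snoc≡∷ʳ []       a = eq₀ a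
  snoc≡∷ʳ (x ∷ xs) a = ≡.trans (eq₁ x xs a) (≡.cong (x ∷_) (snoc≡∷ʳ xs a))

invSeqs-suc : ∀ n → invSeqs (suc n) ≡ concatMap (λ e → map (e ∷ʳ_) (range 0 n)) (invSeqs n)
invSeqs-suc n = concatMap-snoc _ (λ _ → ≡.refl) (λ _ _ _ → ≡.refl) (range 0 n) (invSeqs n)

All-iterate : ∀ a k → All (λ v → a ≤ v × v < a + k) (iterate suc a k)
All-iterate a zero    = []
All-iterate a (suc k) = (≤-refl , m<m+n a (s≤s z≤n)) ∷
  All.map (λ {v} (p , q) → <⇒≤ p , ≡.subst (v <_) (≡.sym (+-suc a k)) q) (All-iterate (suc a) k)

-- The continuations by m entries after i entries have been read. `invSeqs` grows at the end,
-- whereas the automata consume the first letter.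
suffixes : ℕ → ℕ → List (List ℕ)
suffixes i zero    = [] ∷ []
suffixes i (suc m) = concatMap (λ e → map (_∷ e) (range 0 i)) (suffixes (suc i) m)

All-concatMap : ∀ {p q} {A B : Set} {P : A → Set p} {Q : B → Set q} (f : A → List B) {xs} →
  (∀ {x} → P x → All Q (f x)) → All P xs → All Q (concatMap f xs)
All-concatMap f h ps = Allₚ.concat⁺ (Allₚ.map⁺ (All.map h ps))

data Bounded : ℕ → List ℕ → Set where
  []  : ∀ {i} → Bounded i []
  _∷_ : ∀ {i x e} → x ≤ i → Bounded (suc i) e → Bounded i (x ∷ e)

All-range : ∀ a b → All (λ v → a ≤ v × v ≤ b) (range a b)
All-range a b rewrite range≡iterate a b with a ℕ.≤? suc b
... | yes a≤b = All.map (λ {v} (p , q) → p , ℕ.≤-pred (≡.subst (v <_) (m+[n∸m]≡n a≤b) q)) (All-iterate a (suc b ∸ a))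
... | no a≰b rewrite ℕ.m≤n⇒m∸n≡0 (<⇒≤ (ℕ.≰⇒> a≰b)) = []

suffixes-Bounded : ∀ i m → All (Bounded i) (suffixes i m)
suffixes-Bounded i zero    = [] ∷ []
suffixes-Bounded i (suc m) = All-concatMap (λ e → map (_∷ e) (range 0 i))
  (λ bd → Allₚ.map⁺ (All.map (λ (_ , x≤i) → x≤i ∷ bd) (All-range 0 i))) (suffixes-Bounded (suc i) m)

-- Finite sums and guarded terms

module Sums {c ℓ : Level} (R : CommutativeSemiring c ℓ) where
  open CommutativeSemiring R hiding (zero) renaming (_+_ to _⊕_; _*_ to _⊗_)
  open SetoidReasoning setoid
  open CSemigroup +-commutativeSemigroup using (interchange)
  open Compositions R

  infixr 6 _▸_
  _▸_ : Bool → Carrier → Carrier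
  b ▸ x = if b then x else 0#

  ∑ : {A : Set} → List A → (A → Carrier) → Carrier
  ∑ = Σ[_] R

  ∑-cong-All : {A : Set} {f g : A → Carrier} {xs : List A} → All (λ x → f x ≈ g x) xs → ∑ xs f ≈ ∑ xs g
  ∑-cong-All []       = refl
  ∑-cong-All (p ∷ ps) = +-cong p (∑-cong-All ps)

  ∑-cong : {A : Set} {f g : A → Carrier} (xs : List A) → (∀ x → f x ≈ g x) → ∑ xs f ≈ ∑ xs g
  ∑-cong xs f≈g = ∑-cong-All (All.universal f≈g xs)

  ∑-0 : {A : Set} (xs : List A) → ∑ xs (λ _ → 0#) ≈ 0#
  ∑-0 []       = refl
  ∑-0 (x ∷ xs) = trans (+-congˡ (∑-0 xs)) (+-identityˡ 0#)

  ∑-+ : {A : Set} (xs : List A) (f g : A → Carrier) → ∑ xs (λ x → f x ⊕ g x) ≈ ∑ xs f ⊕ ∑ xs g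
  ∑-+ []       f g = sym (+-identityˡ 0#)
  ∑-+ (x ∷ xs) f g = trans (+-congˡ (∑-+ xs f g)) (interchange _ _ _ _)

  ∑-* : {A : Set} (xs : List A) (y : Carrier) (f : A → Carrier) → ∑ xs (λ x → y ⊗ f x) ≈ y ⊗ ∑ xs f
  ∑-* []       y f = sym (zeroʳ y)
  ∑-* (x ∷ xs) y f = trans (+-congˡ (∑-* xs y f)) (sym (distribˡ _ _ _))

  ∑-++ : {A : Set} (xs ys : List A) (f : A → Carrier) → ∑ (xs ++ ys) f ≈ ∑ xs f ⊕ ∑ ys f
  ∑-++ []       ys f = sym (+-identityˡ _)
  ∑-++ (x ∷ xs) ys f = trans (+-congˡ (∑-++ xs ys f)) (sym (+-assoc _ _ _))

  ∑-map : {A B : Set} (h : A → B) (xs : List A) (f : B → Carrier) → ∑ (map h xs) f ≈ ∑ xs (f ∘ h)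
  ∑-map h []       f = refl
  ∑-map h (x ∷ xs) f = +-congˡ (∑-map h xs f)

  ∑-concatMap-map : {A B C : Set} (h : A → B → C) (xs : List B) (ys : List A) (f : C → Carrier) →
    ∑ (concatMap (λ y → map (h y) xs) ys) f ≈ ∑ ys (λ y → ∑ xs (λ x → f (h y x)))
  ∑-concatMap-map h xs []       f = refl
  ∑-concatMap-map h xs (y ∷ ys) f =
    trans (∑-++ (map (h y) xs) _ f) (+-cong (∑-map (h y) xs f) (∑-concatMap-map h xs ys f))

  ∑-filterᵇ : {A : Set} (p : A → Bool) (xs : List A) (f : A → Carrier) →
    ∑ (filterᵇ p xs) f ≈ ∑ xs (λ x → p x ▸ f x)
  ∑-filterᵇ p []       f = refl
  ∑-filterᵇ p (x ∷ xs) f with p x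
  ... | true  = +-congˡ (∑-filterᵇ p xs f)
  ... | false = trans (∑-filterᵇ p xs f) (sym (+-identityˡ _))

  ∑-swap : {A B : Set} (xs : List A) (ys : List B) (f : A → B → Carrier) →
    ∑ xs (λ x → ∑ ys (f x)) ≈ ∑ ys (λ y → ∑ xs (λ x → f x y))
  ∑-swap []       ys f = sym (∑-0 ys)
  ∑-swap (x ∷ xs) ys f = trans (+-congˡ (∑-swap xs ys f)) (sym (∑-+ ys _ _))

  ∑-antidiag : {A : Set} (xs : List A) (m : ℕ) (g : ℕ → ℕ → A → Carrier) →
    ∑ xs (λ x → antidiag m (λ a b → g a b x)) ≈ antidiag m (λ a b → ∑ xs (g a b))
  ∑-antidiag xs zero    g = refl
  ∑-antidiag xs (suc m) g = trans (∑-+ xs _ _) (+-congˡ (∑-antidiag xs m (g ∘ suc)))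

  ∑-δ-absent : ∀ {v} {f : ℕ → Carrier} {xs} → All (_≢ v) xs → ∑ xs (λ x → (x ≡ᵇ v) ▸ f x) ≈ 0#
  ∑-δ-absent []                = refl
  ∑-δ-absent (x≢v ∷ ps) rewrite ≢⇒≡ᵇ-false x≢v = trans (+-identityˡ _) (∑-δ-absent ps)

  ∑-δ-iterate : ∀ a k {v} (f : ℕ → Carrier) → a ≤ v → v < a + k →
    ∑ (iterate suc a k) (λ x → (x ≡ᵇ v) ▸ f x) ≈ f v
  ∑-δ-iterate a zero    f a≤v v<a = contradiction (≡.subst (_ <_) (ℕ.+-identityʳ a) v<a) (≤⇒≯ a≤v)
  ∑-δ-iterate a (suc k) {v} f a≤v v<a+k with a ≟ v
  ... | yes ≡.refl rewrite ≡ᵇ-refl a =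
    trans (+-congˡ (∑-δ-absent (All.map (λ (p , _) → >⇒≢ p) (All-iterate (suc a) k)))) (+-identityʳ _)
  ... | no a≢v rewrite ≢⇒≡ᵇ-false a≢v =
    trans (+-identityˡ _) (∑-δ-iterate (suc a) k f (≤∧≢⇒< a≤v a≢v) (≡.subst (v <_) (+-suc a k) v<a+k))

  ∑-δ-range : ∀ a b {v} (f : ℕ → Carrier) → a ≤ v → v ≤ b → ∑ (range a b) (λ x → (x ≡ᵇ v) ▸ f x) ≈ f v
  ∑-δ-range a b {v} f a≤v v≤b rewrite range≡iterate a b =
    ∑-δ-iterate a (suc b ∸ a) f a≤v (≡.subst (v <_) (≡.sym (m+[n∸m]≡n (m≤n⇒m≤1+n (≤-trans a≤v v≤b)))) (s≤s v≤b))

  -- The bound on an entry depends only on its position, so the sums over the first and over the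
  -- last entry can be interchanged.
  ∑-suffixes-snoc : ∀ i m f →
    ∑ (suffixes i (suc m)) f ≈ ∑ (suffixes i m) (λ e → ∑ (range 0 (i + m)) (λ a → f (e ∷ʳ a)))
  ∑-suffixes-snoc i zero    f rewrite ℕ.+-identityʳ i = ∑-concatMap-map (λ e a → a ∷ e) (range 0 i) ([] ∷ []) f
  ∑-suffixes-snoc i (suc m) f rewrite +-suc i m = begin
    ∑ (suffixes i (suc (suc m))) f
      ≈⟨ ∑-concatMap-map (λ e a → a ∷ e) (range 0 i) (suffixes (suc i) (suc m)) f ⟩
    ∑ (suffixes (suc i) (suc m)) (λ e → ∑ (range 0 i) (λ x → f (x ∷ e)))
      ≈⟨ ∑-suffixes-snoc (suc i) m _ ⟩
    ∑ (suffixes (suc i) m) (λ e → ∑ (range 0 (suc i + m)) (λ a → ∑ (range 0 i) (λ x → f (x ∷ e ∷ʳ a))))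
      ≈⟨ ∑-cong (suffixes (suc i) m) (λ e → ∑-swap (range 0 (suc i + m)) (range 0 i) _) ⟩
    ∑ (suffixes (suc i) m) (λ e → ∑ (range 0 i) (λ x → ∑ (range 0 (suc i + m)) (λ a → f (x ∷ e ∷ʳ a))))
      ≈⟨ ∑-concatMap-map (λ e a → a ∷ e) (range 0 i) (suffixes (suc i) m) _ ⟨
    ∑ (suffixes i (suc m)) (λ e → ∑ (range 0 (suc (i + m))) (λ a → f (e ∷ʳ a))) ∎

  ∑-invSeqs : ∀ n f → ∑ (invSeqs n) f ≈ ∑ (suffixes 0 n) f
  ∑-invSeqs zero    f = refl
  ∑-invSeqs (suc n) f = begin
    ∑ (invSeqs (suc n)) f
      ≡⟨ ≡.cong (λ es → ∑ es f) (invSeqs-suc n) ⟩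
    ∑ (concatMap (λ e → map (e ∷ʳ_) (range 0 n)) (invSeqs n)) f
      ≈⟨ ∑-concatMap-map _∷ʳ_ (range 0 n) (invSeqs n) f ⟩
    ∑ (invSeqs n) (λ e → ∑ (range 0 n) (λ a → f (e ∷ʳ a)))
      ≈⟨ ∑-invSeqs n _ ⟩
    ∑ (suffixes 0 n) (λ e → ∑ (range 0 n) (λ a → f (e ∷ʳ a)))
      ≈⟨ ∑-suffixes-snoc 0 n f ⟨
    ∑ (suffixes 0 (suc n)) f ∎

length-∷ʳ : ∀ {A : Set} (xs : List A) x → length (xs ∷ʳ x) ≡ suc (length xs)
length-∷ʳ xs x = ≡.trans (length-++ xs) (ℕ.+-comm (length xs) 1)

-- The run (l , x) is the interval {l, …, l + x}; lists of runs are ordered from the top down.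
Run : Set
Run = ℕ × ℕ

-- Here b is the size of the new run, which may be empty.
consRun : ℕ → ℕ → List Run → List Run
consRun l zero    rs = rs
consRun l (suc b) rs = (l , b) ∷ rs

InBox : ℕ → Run → Set
InBox n (l , x) = 1 ≤ l × l + x ≤ n

consRun-InBox : ∀ {n l} b {rs} → 1 ≤ l → l + b ≤ n → All (InBox n) rs → All (InBox n) (consRun l b rs)
consRun-InBox             zero    1≤l l+b≤n ps = ps
consRun-InBox {n} {l} (suc b) 1≤l l+b≤n ps =
  (1≤l , ≤-trans (ℕ.+-monoʳ-≤ l (ℕ.n≤1+n b)) l+b≤n) ∷ ps

map-consRun : ∀ l b rs → map proj₂ (consRun l b rs) ≡ consPart b (map proj₂ rs)
map-consRun l zero    rs = ≡.refl
map-consRun l (suc b) rs = ≡.refl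

-- The two automata and their total weights

module Automata {c ℓ : Level} (R : CommutativeSemiring c ℓ)
                (s t : ℕ → CommutativeSemiring.Carrier R) where
  open CommutativeSemiring R hiding (zero) renaming (_+_ to _⊕_; _*_ to _⊗_)
  open SetoidReasoning setoid
  open Compositions R
  open Transfer R s t
  open Sums R

  -- Φ i z L d e sums over the guesses, for each letter x of e, of whether x and the new label i + 1 will
  -- occur again; only the correct guesses contribute, see Φ-spec.
  Φ : ℕ → Bool → List ℕ → Bool → List ℕ → Carrier
  Φ₂ : ℕ → Bool → ℕ → List ℕ → List ℕ → Carrier
  Φ i z []      d []      = 1#
  Φ i z (_ ∷ _) d []      = 0#
  Φ i z []      d (_ ∷ _) = 0#
  Φ i z (l ∷ L) d (x ∷ e) =
    tWeight d i ⊗ ((x ≡ᵇ l) ▸ ((Φ (suc i) z (l ∷ L) true e ⊕ Φ (suc i) z (l ∷ L ∷ʳ suc i) true e)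
       ⊕ sWeight z (suc i) ⊗ (Φ (suc i) false L false e ⊕ Φ (suc i) false (L ∷ʳ suc i) false e)))
    ⊕ Φ₂ i z l L (x ∷ e)
  Φ₂ i z l []       e       = 0#
  Φ₂ i z l (l′ ∷ L) []      = 0#
  Φ₂ i z l (l′ ∷ L) (x ∷ e) =
    (x ≡ᵇ l′) ▸ (t i ⊗ s (suc i)) ⊗ (Φ (suc i) z (l ∷ L) true e ⊕ Φ (suc i) z (l ∷ L ∷ʳ suc i) true e)

  -- Every branch of `Φ` prescribes its next letter, which is at most i and so hit exactly once by
  -- the sum over letters. What survives of L is its length.
  ∑-Φ : ∀ m i z L d → All (_≤ i) L → ∑ (suffixes i m) (Φ i z L d) ≈ pathSum m i (length L) z d
  ∑-Φ zero    i z []      d L≤i = +-identityʳ _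
  ∑-Φ zero    i z (_ ∷ _) d L≤i = +-identityʳ _
  ∑-Φ (suc m) i z []      d L≤i =
    trans (∑-concatMap-map (λ e a → a ∷ e) (range 0 i) (suffixes (suc i) m) _)
    (trans (∑-cong (suffixes (suc i) m) (λ _ → ∑-0 (range 0 i))) (∑-0 (suffixes (suc i) m)))
  ∑-Φ (suc m) i z (l ∷ L) d (l≤i ∷ L≤i) = begin
    ∑ (suffixes i (suc m)) (Φ i z (l ∷ L) d)
      ≈⟨ ∑-concatMap-map (λ e a → a ∷ e) (range 0 i) es (Φ i z (l ∷ L) d) ⟩
    ∑ es (λ e → ∑ (range 0 i) (λ x → Φ i z (l ∷ L) d (x ∷ e)))
      ≈⟨ ∑-cong es (λ e → trans (∑-+ (range 0 i) _ _) (+-congʳ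
           (trans (∑-* (range 0 i) _ _) (*-congˡ (∑-δ-range 0 i (λ _ → first e) z≤n l≤i))))) ⟩
    ∑ es (λ e → tWeight d i ⊗ first e ⊕ ∑ (range 0 i) (λ x → Φ₂ i z l L (x ∷ e)))
      ≈⟨ ∑-+ es _ _ ⟩
    ∑ es (λ e → tWeight d i ⊗ first e) ⊕ ∑ es (λ e → ∑ (range 0 i) (λ x → Φ₂ i z l L (x ∷ e)))
      ≈⟨ +-cong (trans (∑-* es _ _) (*-congˡ (trans (∑-+ es _ _) (+-cong
           (pair z true (l ∷ L) (l≤i ∷ L≤i))
           (trans (∑-* es _ _) (*-congˡ (pair false false L L≤i)))))))
           (second L L≤i) ⟩
    pathSum (suc m) i (suc (length L)) z d ∎
    where
    es = suffixes (suc i) m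

    first : List ℕ → Carrier
    first e = (Φ (suc i) z (l ∷ L) true e ⊕ Φ (suc i) z (l ∷ L ∷ʳ suc i) true e)
       ⊕ sWeight z (suc i) ⊗ (Φ (suc i) false L false e ⊕ Φ (suc i) false (L ∷ʳ suc i) false e)

    pair : ∀ z d L → All (_≤ i) L →
      ∑ es (λ e → Φ (suc i) z L d e ⊕ Φ (suc i) z (L ∷ʳ suc i) d e)
      ≈ pathSum m (suc i) (length L) z d ⊕ pathSum m (suc i) (suc (length L)) z d
    pair z d L L≤i = trans (∑-+ es _ _) (+-cong
      (∑-Φ m (suc i) z L d L≤1+i)
      (trans (∑-Φ m (suc i) z (L ∷ʳ suc i) d (Allₚ.∷ʳ⁺ L≤1+i ≤-refl))
             (reflexive (≡.cong (λ k → pathSum m (suc i) k z d) (length-∷ʳ L (suc i))))))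
      where L≤1+i = All.map m≤n⇒m≤1+n L≤i

    second : ∀ L → All (_≤ i) L →
      ∑ es (λ e → ∑ (range 0 i) (λ x → Φ₂ i z l L (x ∷ e))) ≈ secondRank m i (length L) z
    second []       L≤i = trans (∑-cong es (λ _ → ∑-0 (range 0 i))) (∑-0 es)
    second (l′ ∷ L) (l′≤i ∷ L≤i) = begin
      _ ≈⟨ ∑-cong es (λ e → ∑-δ-range 0 i (λ _ → _) z≤n l′≤i) ⟩
      _ ≈⟨ ∑-* es _ _ ⟩
      _ ≈⟨ *-congˡ (pair z true (l ∷ L) (l≤i ∷ L≤i)) ⟩
      _ ∎

  -- Nothing is guessed here: the letter q determines where the run breaks. The sum over all splits
  -- has at most one nonzero term for given q and is written out so that summing over q yields
  -- `sizesSum`.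
  Ψ : ℕ → Bool → List Run → Bool → List ℕ → Carrier
  Ψ₁ : ℕ → Bool → ℕ → List Run → ℕ → ℕ → List ℕ → Carrier
  Ψ₂ : ℕ → Bool → Run → List Run → List ℕ → Carrier
  Ψ i z []             d []      = 1#
  Ψ i z (_ ∷ _)        d []      = 0#
  Ψ i z []             d (_ ∷ _) = 0#
  Ψ i z ((l , x) ∷ rs) d (q ∷ w) =
    tWeight d i ⊗ antidiag x (λ a b → (q ≡ᵇ l + b) ▸ Ψ₁ i z l rs a b w) ⊕ Ψ₂ i z (l , x) rs (q ∷ w)
  Ψ₁ i z l rs zero    b w = sWeight z (suc i) ⊗ Ψ (suc i) false (consRun l b rs) false w
  Ψ₁ i z l rs (suc a) b w = Ψ (suc i) z ((suc (l + b) , a) ∷ consRun l b rs) true w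
  Ψ₂ i z r []              w       = 0#
  Ψ₂ i z r ((l , x) ∷ rs) []      = 0#
  Ψ₂ i z r ((l , x) ∷ rs) (q ∷ w) =
    (q ≡ᵇ l + x) ▸ (t i ⊗ s (suc i)) ⊗ Ψ (suc i) z (r ∷ consRun l x rs) true w

  ∑-Ψ : ∀ n m i z rs d → All (InBox n) rs → ∑ (words m n) (Ψ i z rs d) ≈ sizesSum m i z (map proj₂ rs) d
  ∑-Ψ n zero    i z []      d box = +-identityʳ _
  ∑-Ψ n zero    i z (_ ∷ _) d box = +-identityʳ _
  ∑-Ψ n (suc m) i z []      d box =
    trans (∑-concatMap-map (λ e a → a ∷ e) (range 1 n) (words m n) _)
    (trans (∑-cong (words m n) (λ _ → ∑-0 (range 1 n))) (∑-0 (words m n)))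
  ∑-Ψ n (suc m) i z ((l , x) ∷ rs) d ((1≤l , l+x≤n) ∷ box) = begin
    ∑ (words (suc m) n) (Ψ i z ((l , x) ∷ rs) d)
      ≈⟨ ∑-concatMap-map (λ e a → a ∷ e) (range 1 n) ws (Ψ i z ((l , x) ∷ rs) d) ⟩
    ∑ ws (λ w → ∑ (range 1 n) (λ q → Ψ i z ((l , x) ∷ rs) d (q ∷ w)))
      ≈⟨ ∑-cong ws (λ w → trans (∑-+ (range 1 n) _ _) (+-congʳ
           (trans (∑-* (range 1 n) _ _) (*-congˡ (trans (∑-antidiag (range 1 n) x _)
             (antidiag-cong-≡ x (λ a b a+b≡x →
               ∑-δ-range 1 n (λ _ → Ψ₁ i z l rs a b w) (lower b) (upper a b a+b≡x)))))))) ⟩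
    ∑ ws (λ w → tWeight d i ⊗ antidiag x (λ a b → Ψ₁ i z l rs a b w) ⊕ ∑ (range 1 n) (λ q → Ψ₂ i z (l , x) rs (q ∷ w)))
      ≈⟨ ∑-+ ws _ _ ⟩
    _ ≈⟨ +-cong
           (trans (∑-* ws _ _) (*-congˡ (trans (∑-antidiag ws x _) (antidiag-cong-≡ x first))))
           (second rs box) ⟩
    sizesSum (suc m) i z (x ∷ map proj₂ rs) d ∎
    where
    ws = words m n

    lower : ∀ b → 1 ≤ l + b
    lower b = ≤-trans 1≤l (ℕ.m≤m+n l b)

    upper : ∀ a b → a + b ≡ x → l + b ≤ n
    upper a b ≡.refl = ≤-trans (ℕ.+-monoʳ-≤ l (ℕ.m≤n+m b a)) l+x≤n

    first : ∀ a b → a + b ≡ x → ∑ ws (Ψ₁ i z l rs a b) ≈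
      ifZero (λ ds → sWeight z (suc i) ⊗ sizesSum m (suc i) false ds false)
             (λ ds → sizesSum m (suc i) z ds true) a (consPart b (map proj₂ rs))
    first zero b eq = trans (∑-* ws _ _) (*-congˡ (trans
      (∑-Ψ n m (suc i) false (consRun l b rs) false (consRun-InBox b 1≤l (upper 0 b eq) box))
      (reflexive (≡.cong (λ ds → sizesSum m (suc i) false ds false) (map-consRun l b rs)))))
    first (suc a) b eq = trans
      (∑-Ψ n m (suc i) z ((suc (l + b) , a) ∷ consRun l b rs) true
        ((s≤s z≤n , ≡.subst (_≤ n) reassoc l+x≤n) ∷ consRun-InBox b 1≤l (upper (suc a) b eq) box))
      (reflexive (≡.cong (λ ds → sizesSum m (suc i) z (a ∷ ds) true) (map-consRun l b rs)))
      where
      reassoc : l + x ≡ suc (l + b + a)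
      reassoc = ≡.trans (≡.cong (l +_) (≡.trans (≡.sym eq) (ℕ.+-comm (suc a) b)))
                (≡.trans (≡.sym (ℕ.+-assoc l b (suc a))) (+-suc (l + b) a))

    second : ∀ rs → All (InBox n) rs → ∑ ws (λ w → ∑ (range 1 n) (λ q → Ψ₂ i z (l , x) rs (q ∷ w)))
      ≈ onCons (λ y ds → (t i ⊗ s (suc i)) ⊗ sizesSum m (suc i) z (x ∷ consPart y ds) true) (map proj₂ rs)
    second []              box = trans (∑-cong ws (λ _ → ∑-0 (range 1 n))) (∑-0 ws)
    second ((l′ , y) ∷ rs) ((1≤l′ , l′+y≤n) ∷ box) = begin
      _ ≈⟨ ∑-cong ws (λ w → ∑-δ-range 1 n (λ _ → _) (≤-trans 1≤l′ (ℕ.m≤m+n l′ y)) l′+y≤n) ⟩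
      _ ≈⟨ ∑-* ws _ _ ⟩
      _ ≈⟨ *-congˡ (∑-Ψ n m (suc i) z ((l , x) ∷ consRun l′ y rs) true
             ((1≤l , l+x≤n) ∷ consRun-InBox y 1≤l′ l′+y≤n box)) ⟩
      _ ≡⟨ ≡.cong (λ ds → (t i ⊗ s (suc i)) ⊗ sizesSum m (suc i) z (x ∷ ds) true) (map-consRun l′ y rs) ⟩
      _ ∎

-- Labels of an inversion sequence and their invariants

LabelsOf : ℕ → List ℕ → List ℕ → Set
LabelsOf i L e = (∀ {v} → v ≤ i → v ∈ e → v ∈ L) × (∀ {v} → v ∈ L → v ∈ e)

-- With e the entries after x, this says that no (≥,≠,≥) occurrence begins at x. The order of y and
-- z is irrelevant, as the pattern is symmetric in its last two entries.
AtMostOneBelow : ℕ → List ℕ → Set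
AtMostOneBelow x e = ∀ y z → y ∈ e → z ∈ e → y ≤ x → z ≤ x → y ≡ z

Admissible : List ℕ → Set
Admissible []      = ⊤
Admissible (x ∷ e) = AtMostOneBelow x e × Admissible e

-- In an increasing list the label 0 can only be the head.
ZeroFlag : Bool → List ℕ → Set
ZeroFlag z []      = z ≡ false
ZeroFlag z (l ∷ L) = if z then l ≡ 0 else l ≢ 0

NotHead : ℕ → List ℕ → Set
NotHead x []      = ⊤
NotHead x (l ∷ L) = x ≢ l

head? : ∀ x L → NotHead x L ⊎ ∃ λ L′ → L ≡ x ∷ L′
head? x []      = inj₁ tt
head? x (l ∷ L) with x ≟ l
... | yes ≡.refl = inj₂ (L , ≡.refl)
... | no x≢l     = inj₁ x≢l

All-<⇒NotHead : ∀ {x L} → All (x <_) L → NotHead x L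
All-<⇒NotHead []          = tt
All-<⇒NotHead (x<l ∷ _) = ℕ.<⇒≢ x<l

-- For the previous letter p, admissibility leaves at most one label up to p; the flag tells whether
-- there is one.
LastFlag : Bool → ℕ → List ℕ → Set
LastFlag true  p []      = ⊥
LastFlag true  p (l ∷ L) = l ≤ p × All (p <_) L
LastFlag false p L       = All (p <_) L

ZeroFlag-∷ʳ : ∀ z L i → ZeroFlag z L → ZeroFlag z (L ∷ʳ suc i)
ZeroFlag-∷ʳ false []      i _ ()
ZeroFlag-∷ʳ z     (_ ∷ _) i p = p

LastFlag-∷ʳ : ∀ d {p} L {v} → p < v → LastFlag d p L → LastFlag d p (L ∷ʳ v)
LastFlag-∷ʳ true  (_ ∷ _) p<v (l≤p , p<L) = l≤p , Allₚ.∷ʳ⁺ p<L p<v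
LastFlag-∷ʳ false L       p<v p<L         = Allₚ.∷ʳ⁺ p<L p<v

∷ʳ-sorted : ∀ {L v} → AllPairs _<_ L → All (_< v) L → AllPairs _<_ (L ∷ʳ v)
∷ʳ-sorted ap L<v = AllPairsₚ.++⁺ ap ([] ∷ []) (All.map (_∷ []) L<v)

∈-∷ʳ⁻ : ∀ {A : Set} {v x : A} xs → v ∈ xs ∷ʳ x → v ≢ x → v ∈ xs
∈-∷ʳ⁻ xs v∈ v≢x with ∈-++⁻ xs v∈
... | inj₁ v∈xs        = v∈xs
... | inj₂ (here v≡x) = contradiction v≡x v≢x

∈-tail : ∀ {A : Set} {v x : A} {xs} → v ∈ x ∷ xs → v ≢ x → v ∈ xs
∈-tail (here v≡x)  v≢x = contradiction v≡x v≢x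
∈-tail (there v∈) v≢x = v∈

All-<⇒∉ : ∀ {x L} → All (x <_) L → x ∉ L
All-<⇒∉ x<L x∈L = ℕ.<-irrefl ≡.refl (All.lookup x<L x∈L)

labels-new : ∀ {i L e} → LabelsOf i L e → suc i ∈ e → LabelsOf (suc i) (L ∷ʳ suc i) e
labels-new {i} {L} (⊆L , L⊆) new = to , from
  where
  to : ∀ {v} → v ≤ suc i → _ → v ∈ L ∷ʳ suc i
  to {v} v≤ v∈e with v ≟ suc i
  ... | yes ≡.refl = ∈-++⁺ʳ L (here ≡.refl)
  ... | no v≢      = ∈-++⁺ˡ (⊆L (ℕ.≤-pred (≤∧≢⇒< v≤ v≢)) v∈e)
  from : ∀ {v} → v ∈ L ∷ʳ suc i → _
  from {v} v∈ with v ≟ suc i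
  ... | yes ≡.refl = new
  ... | no v≢      = L⊆ (∈-∷ʳ⁻ L v∈ v≢)

labels-old : ∀ {i L e} → LabelsOf i L e → suc i ∉ e → LabelsOf (suc i) L e
labels-old {i} {L} {e} (⊆L , L⊆) old =
  (λ v≤ v∈e → ⊆L (ℕ.≤-pred (≤∧≢⇒< v≤ (λ eq → old (≡.subst (_∈ e) eq v∈e)))) v∈e) , L⊆

labels-new⁻ : ∀ {i L e} → LabelsOf (suc i) (L ∷ʳ suc i) e → LabelsOf i L e
labels-new⁻ {i} {L} (⊆L , L⊆) =
  (λ v≤i v∈e → ∈-∷ʳ⁻ L (⊆L (m≤n⇒m≤1+n v≤i) v∈e) (ℕ.<⇒≢ (s≤s v≤i))) , L⊆ ∘ ∈-++⁺ˡ

labels-old⁻ : ∀ {i L e} → LabelsOf (suc i) L e → LabelsOf i L e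
labels-old⁻ (⊆L , L⊆) = (λ v≤i → ⊆L (m≤n⇒m≤1+n v≤i)) , L⊆

labels-keep : ∀ {i L x e} → x ≤ i → x ∈ e → LabelsOf i L e → LabelsOf i L (x ∷ e)
labels-keep x≤i x∈e (⊆L , L⊆) = (λ { v≤i (here ≡.refl) → ⊆L x≤i x∈e ; v≤i (there v∈e) → ⊆L v≤i v∈e }) , there ∘ L⊆

labels-keep⁻ : ∀ {i L x e} → x ∈ e → LabelsOf i L (x ∷ e) → LabelsOf i L e
labels-keep⁻ {x = x} {e} x∈e (⊆L , L⊆) = (λ v≤i v∈e → ⊆L v≤i (there v∈e)) , λ v∈L → absorb (L⊆ v∈L)
  where
  absorb : ∀ {v} → v ∈ x ∷ e → v ∈ e
  absorb (here ≡.refl) = x∈e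
  absorb (there v∈e)   = v∈e

record IsErasure (x : ℕ) (L L′ : List ℕ) : Set where
  field
    split  : ∀ {v} → v ∈ L → v ≢ x → v ∈ L′
    member : x ∈ L
    embed  : ∀ {v} → v ∈ L′ → v ∈ L
    absent : x ∉ L′

labels-drop : ∀ {i x L L′ e} → IsErasure x L L′ → LabelsOf i L′ e → LabelsOf i L (x ∷ e)
labels-drop {i} {x} {L} {L′} {e} er (⊆L , L⊆) =
  (λ { v≤i (here ≡.refl) → member ; v≤i (there v∈e) → embed (⊆L v≤i v∈e) }) , from
  where
  open IsErasure er
  from : ∀ {v} → v ∈ L → v ∈ x ∷ e
  from {v} v∈L with v ≟ x
  ... | yes v≡x = here v≡x
  ... | no v≢x  = there (L⊆ (split v∈L v≢x))

labels-drop⁻ : ∀ {i x L L′ e} → IsErasure x L L′ → x ∉ e → LabelsOf i L (x ∷ e) → LabelsOf i L′ e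
labels-drop⁻ {e = e} er x∉e (⊆L , L⊆) =
  (λ v≤i v∈e → split (⊆L v≤i (there v∈e)) (λ { ≡.refl → x∉e v∈e })) ,
  (λ v∈L′ → ∈-tail (L⊆ (embed v∈L′)) (λ { ≡.refl → absent v∈L′ }))
  where open IsErasure er

IsErasure-head : ∀ {x L} → All (x <_) L → IsErasure x (x ∷ L) L
IsErasure-head x<L = record { split = ∈-tail ; member = here ≡.refl ; embed = there ; absent = All-<⇒∉ x<L }

IsErasure-second : ∀ {l x L} → l < x → All (x <_) L → IsErasure x (l ∷ x ∷ L) (l ∷ L)
IsErasure-second l<x x<L = record
  { split  = λ { (here eq) _ → here eq ; (there v∈) v≢x → there (∈-tail v∈ v≢x) }
  ; member = there (here ≡.refl)
  ; embed  = λ { (here eq) → here eq ; (there v∈) → there (there v∈) }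
  ; absent = λ { (here ≡.refl) → ℕ.<-irrefl ≡.refl l<x ; (there x∈L) → All-<⇒∉ x<L x∈L }
  }

ZeroFlag-tail : ∀ {l} L → All (l <_) L → ZeroFlag false L
ZeroFlag-tail []      _           = ≡.refl
ZeroFlag-tail (_ ∷ _) (s≤s _ ∷ _) ()

-- A later entry up to x is at most i, hence a label, and x is the only label in that range.
min-AtMostOneBelow : ∀ {i x L e} → x ≤ i → All (x <_) L → LabelsOf i (x ∷ L) (x ∷ e) → AtMostOneBelow x e
min-AtMostOneBelow {i} {x} {L} {e} x≤i x<L (⊆L , _) y z y∈ z∈ y≤x z≤x = ≡.trans (only y∈ y≤x) (≡.sym (only z∈ z≤x))
  where
  only : ∀ {y} → y ∈ e → y ≤ x → y ≡ x
  only y∈e y≤x with ⊆L (≤-trans y≤x x≤i) (there y∈e)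
  ... | here y≡x  = y≡x
  ... | there y∈L = contradiction (All.lookup x<L y∈L) (≤⇒≯ y≤x)

-- As x does not return, l is the only label up to x that can still occur.
second-AtMostOneBelow : ∀ {i l x L e} → x ≤ i → x ∉ e → All (x <_) L →
  LabelsOf i (l ∷ x ∷ L) (x ∷ e) → AtMostOneBelow x e
second-AtMostOneBelow {i} {l} {x} {L} {e} x≤i x∉e x<L (⊆L , _) y z y∈ z∈ y≤x z≤x =
  ≡.trans (only y∈ y≤x) (≡.sym (only z∈ z≤x))
  where
  only : ∀ {y} → y ∈ e → y ≤ x → y ≡ l
  only y∈e y≤x with ⊆L (≤-trans y≤x x≤i) (there y∈e)
  ... | here y≡l            = y≡l
  ... | there (here ≡.refl) = contradiction y∈e x∉e
  ... | there (there y∈L)   = contradiction (All.lookup x<L y∈L) (≤⇒≯ y≤x)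

-- Weighted indicators

module Specs {c ℓ : Level} (R : CommutativeSemiring c ℓ) where
  open CommutativeSemiring R hiding (zero) renaming (_+_ to _⊕_; _*_ to _⊗_)

  weigh : ∀ {p} {A : Set p} → Dec A → Carrier → Carrier
  weigh a? y = if does a? then y else 1#

  weigh-yes : ∀ {p} {A : Set p} (a? : Dec A) y → A → weigh a? y ≡ y
  weigh-yes a? y a rewrite dec-true a? a = ≡.refl

  weigh-no : ∀ {p} {A : Set p} (a? : Dec A) y → ¬ A → weigh a? y ≡ 1#
  weigh-no a? y ¬a rewrite dec-false a? ¬a = ≡.refl

  -- a is b times the indicator of G, without assuming G decidable.
  record Spec (G : Set) (a b : Carrier) : Set ℓ where
    constructor spec
    field
      holds : G → a ≈ b
      fails : ¬ G → a ≈ 0#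
  open Spec

  spec-map : ∀ {G H a a′ b b′} → (G → H) → (H → G) → (G → a ≈ b → a′ ≈ b′) → (a ≈ 0# → a′ ≈ 0#) →
    Spec H a b → Spec G a′ b′
  spec-map to from f g sp = spec (λ g′ → f g′ (holds sp (to g′))) (λ ¬G → g (fails sp (¬G ∘ from)))

  spec-0 : ∀ {G a b} → ¬ G → a ≈ 0# → Spec G a b
  spec-0 ¬G a≈0 = spec (λ g → contradiction g ¬G) (λ _ → a≈0)

-- The label automaton weighs the admissible inversion sequences

module InvSeqWeight {c ℓ : Level} (R : CommutativeSemiring c ℓ)
                (s t : ℕ → CommutativeSemiring.Carrier R) where
  open CommutativeSemiring R hiding (zero) renaming (_+_ to _⊕_; _*_ to _⊗_)
  open Transfer R s t
  open Sums R
  open Automata R s t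
  open Specs R
  open Spec

  firstOnly : ∀ τ σ {a b c y} → b ≈ 0# → c ≈ 0# → a ≈ y → τ ⊗ (a ⊕ σ ⊗ b) ⊕ c ≈ τ ⊗ y
  firstOnly τ σ b≈0 c≈0 a≈y = trans (+-cong (*-congˡ (trans
    (+-cong a≈y (trans (*-congˡ b≈0) (zeroʳ σ))) (+-identityʳ _))) c≈0) (+-identityʳ _)

  secondOnly : ∀ τ σ {a b c y} → a ≈ 0# → c ≈ 0# → b ≈ y → τ ⊗ (a ⊕ σ ⊗ b) ⊕ c ≈ (σ ⊗ τ) ⊗ y
  secondOnly τ σ a≈0 c≈0 b≈y = trans (+-cong (*-congˡ (trans
    (+-cong a≈0 (*-congˡ b≈y)) (+-identityˡ _))) c≈0) (trans (+-identityʳ _)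
    (trans (sym (*-assoc τ σ _)) (*-congʳ (*-comm τ σ))))

  thirdOnly : ∀ τ {c y} → c ≈ y → τ ⊗ 0# ⊕ c ≈ y
  thirdOnly τ c≈y = trans (+-cong (zeroʳ τ) c≈y) (+-identityˡ _)

  invSeqWeight : ℕ → ℕ → List ℕ → Carrier
  invSeqWeight i p []      = 1#
  invSeqWeight i p (x ∷ e) =
    (weigh (¬? (x ≟ 0) ×-dec ¬? (x ∈? e)) (s (suc i)) ⊗ weigh (p <? x) (t i)) ⊗ invSeqWeight (suc i) x e

  tWeight-min : ∀ d i {p l L} → LastFlag d p (l ∷ L) → weigh (p <? l) (t i) ≡ tWeight d i
  tWeight-min true  i (l≤p , _)  = weigh-no (_ <? _) (t i) (≤⇒≯ l≤p)
  tWeight-min false i (p<l ∷ _) = weigh-yes (_ <? _) (t i) p<l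

  LastFlag-second : ∀ d {p l l′ L} → LastFlag d p (l ∷ l′ ∷ L) → p < l′
  LastFlag-second true  (_ , p<l′ ∷ _)   = p<l′
  LastFlag-second false (_ ∷ p<l′ ∷ _) = p<l′

  sWeight-min : ∀ z i {l L e} → ZeroFlag z (l ∷ L) → l ∉ e →
    weigh (¬? (l ≟ 0) ×-dec ¬? (l ∈? e)) (s i) ≡ sWeight z i
  sWeight-min true  i {l} {e = e} l≡0 l∉e = weigh-no (¬? (l ≟ 0) ×-dec ¬? (l ∈? e)) (s i) (λ (l≢0 , _) → l≢0 l≡0)
  sWeight-min false i {l} {e = e} l≢0 l∉e = weigh-yes (¬? (l ≟ 0) ×-dec ¬? (l ∈? e)) (s i) (l≢0 , l∉e)

  -- Induction on e. Whether x and suc i occur in the rest decides which guess is right; for every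
  -- wrong guess the induction hypothesis gives 0, as its list is not the list of labels of the
  -- rest.
  Φ-spec : ∀ i z L d p e → AllPairs _<_ L → All (_≤ i) L → ZeroFlag z L → LastFlag d p L → Bounded i e →
    Spec (LabelsOf i L e × Admissible e) (Φ i z L d e) (invSeqWeight i p e)
  Φ-spec i z []      d p []      _ _ _ _ _ = spec (λ _ → refl)
    (λ ¬G → ⊥-elim (¬G (((λ _ ()) , λ ()) , tt)))
  Φ-spec i z (l ∷ L) d p []      _ _ _ _ _ = spec-0 (λ ((_ , L⊆) , _) → case (L⊆ (here ≡.refl))) refl
    where
    case : l ∈ [] → ⊥
    case ()
  Φ-spec i z []      d p (x ∷ e) _ _ _ _ (x≤i ∷ _) = spec-0 (λ ((⊆L , _) , _) → case (⊆L x≤i (here ≡.refl))) refl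
    where
    case : x ∈ [] → ⊥
    case ()
  Φ-spec i z (l ∷ L) d p (x ∷ e) (l<L ∷ sorted) (l≤i ∷ L≤i) zf lf (x≤i ∷ bd) = go (x ≟ l)
    where
    pair : ∀ z L d → AllPairs _<_ L → All (_≤ i) L → ZeroFlag z L → LastFlag d x L →
      Spec (LabelsOf i L e × Admissible e) (Φ (suc i) z L d e ⊕ Φ (suc i) z (L ∷ʳ suc i) d e) (invSeqWeight (suc i) x e)
    pair z L d sorted L≤i zf lf with suc i ∈? e
    ... | yes new = spec-map (λ (lab , ad) → labels-new lab new , ad) (λ (lab , ad) → labels-new⁻ lab , ad)
            (λ _ eq → trans (+-cong old≈0 eq) (+-identityˡ _)) (λ eq → trans (+-cong old≈0 eq) (+-identityˡ _))
            (Φ-spec (suc i) z (L ∷ʳ suc i) d x e (∷ʳ-sorted sorted (All.map s≤s L≤i))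
              (Allₚ.∷ʳ⁺ (All.map m≤n⇒m≤1+n L≤i) ≤-refl) (ZeroFlag-∷ʳ z L i zf) (LastFlag-∷ʳ d L (s≤s x≤i) lf) bd)
      where
      old≈0 = fails (Φ-spec (suc i) z L d x e sorted (All.map m≤n⇒m≤1+n L≤i) zf lf bd)
        (λ ((⊆L , _) , _) → ℕ.<-irrefl ≡.refl (All.lookup L≤i (⊆L ≤-refl new)))
    ... | no old = spec-map (λ (lab , ad) → labels-old lab old , ad) (λ (lab , ad) → labels-old⁻ lab , ad)
            (λ _ eq → trans (+-cong eq new≈0) (+-identityʳ _)) (λ eq → trans (+-cong eq new≈0) (+-identityʳ _))
            (Φ-spec (suc i) z L d x e sorted (All.map m≤n⇒m≤1+n L≤i) zf lf bd)
      where
      new≈0 = fails (Φ-spec (suc i) z (L ∷ʳ suc i) d x e (∷ʳ-sorted sorted (All.map s≤s L≤i))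
              (Allₚ.∷ʳ⁺ (All.map m≤n⇒m≤1+n L≤i) ≤-refl) (ZeroFlag-∷ʳ z L i zf) (LastFlag-∷ʳ d L (s≤s x≤i) lf) bd)
        (λ ((_ , L⊆) , _) → old (L⊆ (∈-++⁺ʳ L (here ≡.refl))))

    Φ₂-0 : ∀ L → NotHead x L → Φ₂ i z l L (x ∷ e) ≈ 0#
    Φ₂-0 []       _    = refl
    Φ₂-0 (l′ ∷ L) x≢l′ rewrite ≢⇒≡ᵇ-false x≢l′ = refl

    Goal : Set ℓ
    Goal = Spec (LabelsOf i (l ∷ L) (x ∷ e) × Admissible (x ∷ e)) (Φ i z (l ∷ L) d (x ∷ e)) (invSeqWeight i p (x ∷ e))

    first : x ≡ l → Dec (x ∈ e) → Goal
    first ≡.refl x∈?e rewrite ≡ᵇ-refl x | tWeight-min d i {L = L} lf = byMember x∈?e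
      where
      rest≈0 = Φ₂-0 L (All-<⇒NotHead l<L)
      keep = pair z (x ∷ L) true (l<L ∷ sorted) (l≤i ∷ L≤i) zf (≤-refl , l<L)
      drop = pair false L false sorted L≤i (ZeroFlag-tail L l<L) l<L
      er = IsErasure-head l<L
      byMember : Dec (x ∈ e) → _
      byMember (yes x∈e) = spec-map
        (λ (lab , _ , ad) → labels-keep⁻ x∈e lab , ad)
        (λ (lab , ad) → let lab′ = labels-keep x≤i x∈e lab in lab′ , min-AtMostOneBelow x≤i l<L lab′ , ad)
        (λ _ eq → trans (firstOnly _ _ drop≈0 rest≈0 eq) (*-congʳ (sym (trans (*-congʳ (reflexive
           (weigh-no (¬? (x ≟ 0) ×-dec ¬? (x ∈? e)) (s (suc i)) (λ (_ , x∉e) → x∉e x∈e)))) (*-identityˡ _)))))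
        (λ eq → trans (firstOnly _ _ drop≈0 rest≈0 eq) (zeroʳ _))
        keep
        where
        drop≈0 = fails drop (λ ((⊆L , _) , _) → All-<⇒∉ l<L (⊆L x≤i x∈e))
      byMember (no x∉e) = spec-map
        (λ (lab , _ , ad) → labels-drop⁻ er x∉e lab , ad)
        (λ (lab , ad) → let lab′ = labels-drop er lab in lab′ , min-AtMostOneBelow x≤i l<L lab′ , ad)
        (λ _ eq → trans (secondOnly _ _ keep≈0 rest≈0 eq) (*-congʳ (*-congʳ (reflexive
           (≡.sym (sWeight-min z (suc i) {L = L} zf x∉e))))))
        (λ eq → trans (secondOnly _ _ keep≈0 rest≈0 eq) (zeroʳ _))
        drop
        where
        keep≈0 = fails keep (λ ((_ , L⊆) , _) → x∉e (L⊆ (here ≡.refl)))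

    other : x ≢ l → NotHead x L → Goal
    other x≢l x≢ rewrite ≢⇒≡ᵇ-false x≢l = spec-0 (bad L l<L sorted x≢) (thirdOnly _ (Φ₂-0 L x≢))
      where
      -- A letter beyond the first two labels l and l′ leaves both of them to come, distinct and
      -- below x.
      bad : ∀ L → All (l <_) L → AllPairs _<_ L → NotHead x L →
        ¬ (LabelsOf i (l ∷ L) (x ∷ e) × Admissible (x ∷ e))
      bad L l<L sorted x≢ ((⊆L , L⊆) , below , _) with ∈-tail (⊆L x≤i (here ≡.refl)) x≢l
      bad (l′ ∷ L) (l<l′ ∷ l<L) (l′<L ∷ _) x≢ ((⊆L , L⊆) , below , _) | x∈ with ∈-tail x∈ x≢
      ... | x∈L = ℕ.<⇒≢ l<l′ (below _ _ (∈-tail (L⊆ (here ≡.refl)) (x≢l ∘ ≡.sym))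
        (∈-tail (L⊆ (there (here ≡.refl))) (x≢ ∘ ≡.sym))
        (<⇒≤ (All.lookup l<L x∈L)) (<⇒≤ (All.lookup l′<L x∈L)))

    second : x ≢ l → ∀ {L′} → L ≡ x ∷ L′ → Dec (x ∈ e) → Goal
    second x≢l {L′} ≡.refl x∈?e rewrite ≢⇒≡ᵇ-false x≢l | ≡ᵇ-refl x = byMember x∈?e l<L sorted L≤i
      where
      byMember : Dec (x ∈ e) → All (l <_) (x ∷ L′) → AllPairs _<_ (x ∷ L′) → All (_≤ i) (x ∷ L′) → _
      byMember x∈?e (l<x ∷ l<L′) (x<L′ ∷ sorted′) (_ ∷ L′≤i) with x∈?e
      -- If x returns, then l and x are two different later entries not exceeding x.
      ... | yes x∈e = spec-0
        (λ ((_ , L⊆) , below , _) → ℕ.<⇒≢ l<x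
          (below _ _ (∈-tail (L⊆ (here ≡.refl)) (ℕ.<⇒≢ l<x)) x∈e (<⇒≤ l<x) ≤-refl))
        (thirdOnly _ (trans (*-congˡ (fails keep (λ ((⊆L , _) , _) → IsErasure.absent er (⊆L x≤i x∈e)))) (zeroʳ _)))
        where
        er = IsErasure-second l<x x<L′
        keep = pair z (l ∷ L′) true (l<L′ ∷ sorted′) (l≤i ∷ L′≤i) zf (<⇒≤ l<x , x<L′)
      ... | no x∉e = spec-map
        (λ (lab , _ , ad) → labels-drop⁻ er x∉e lab , ad)
        (λ (lab , ad) → let lab′ = labels-drop er lab in lab′ , second-AtMostOneBelow x≤i x∉e x<L′ lab′ , ad)
        (λ _ eq → thirdOnly _ (trans (*-congˡ eq) (*-congʳ (trans (*-comm _ _) (*-cong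
          (reflexive (≡.sym (weigh-yes (¬? (x ≟ 0) ×-dec ¬? (x ∈? e)) (s (suc i)) (ℕ.m<n⇒n≢0 l<x , x∉e))))
          (reflexive (≡.sym (weigh-yes (p <? x) (t i) (LastFlag-second d lf)))))))))
        (λ eq → thirdOnly _ (trans (*-congˡ eq) (zeroʳ _)))
        keep
        where
        er = IsErasure-second l<x x<L′
        keep = pair z (l ∷ L′) true (l<L′ ∷ sorted′) (l≤i ∷ L′≤i) zf (<⇒≤ l<x , x<L′)

    go : Dec (x ≡ l) → Goal
    go (yes x≡l) = first x≡l (x ∈? e)
    go (no x≢l) with head? x L
    ... | inj₁ x≢        = other x≢l x≢
    ... | inj₂ (_ , L≡) = second x≢l L≡ (x ∈? e)

record Arrangement (S : ℕ → Set) (w : List ℕ) : Set where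
  constructor arrangement
  field
    unique   : Unique w
    sound    : ∀ {v} → v ∈ w → S v
    complete : ∀ {v} → S v → v ∈ w

arrangement-map : ∀ {S S′ : ℕ → Set} {w} → (∀ {v} → S v → S′ v) → (∀ {v} → S′ v → S v) →
  Arrangement S w → Arrangement S′ w
arrangement-map to from (arrangement uniq sound complete) = arrangement uniq (to ∘ sound) (complete ∘ from)

record Erasure (q : ℕ) (S S′ : ℕ → Set) : Set where
  field
    split  : ∀ {v} → S v → v ≢ q → S′ v
    member : S q
    embed  : ∀ {v} → S′ v → S v
    absent : ¬ S′ q

arrangement-tail : ∀ {q S S′ w} → Erasure q S S′ → Arrangement S (q ∷ w) → Arrangement S′ w
arrangement-tail er (arrangement (q∉w ∷ uniq) sound complete) = arrangement uniq
  (λ v∈w → split (sound (there v∈w)) (λ { ≡.refl → All.lookup q∉w v∈w ≡.refl }))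
  (λ S′v → ∈-tail (complete (embed S′v)) (λ { ≡.refl → absent S′v }))
  where open Erasure er

arrangement-cons : ∀ {q S S′ w} → Erasure q S S′ → Arrangement S′ w → Arrangement S (q ∷ w)
arrangement-cons {q} {S} {S′} {w} er (arrangement uniq sound complete) = arrangement
  (All.tabulate (λ { v∈w ≡.refl → absent (sound v∈w) }) ∷ uniq)
  (λ { (here ≡.refl) → member ; (there v∈w) → embed (sound v∈w) })
  from
  where
  open Erasure er
  from : ∀ {v} → S v → v ∈ q ∷ w
  from {v} Sv with v ≟ q
  ... | yes v≡q = here v≡q
  ... | no v≢q  = there (complete (split Sv v≢q))

InRun : ℕ → Run → Set
InRun v (l , x) = l ≤ v × v ≤ l + x

InRuns : List Run → ℕ → Set
InRuns rs v = Any (InRun v) rs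

TopBelow : ℕ → Run → Set
TopBelow u (l , x) = l + x < u

-- The strict gap leaves between neighbouring runs a value belonging to neither: the runs are
-- maximal intervals.
Separated : List Run → Set
Separated = AllPairs (λ (l , _) (l′ , x′) → suc (l′ + x′) < l)

-- Letters absent from w have been used before, so this says that q is not the 1 of a 3142 or 3124.
OneRunAbove : ℕ → List ℕ → Set
OneRunAbove q w = ∀ y c z → y ∈ w → c ∉ w → z ∈ w → q < y → y < c → ¬ c < z

PermAdmissible : List ℕ → Set
PermAdmissible []      = ⊤
PermAdmissible (q ∷ w) = OneRunAbove q w × PermAdmissible w

TopFlag : ℕ → Bool → List Run → Set
TopFlag n z []             = z ≡ false
TopFlag n z ((l , x) ∷ rs) = if z then l + x ≡ n else l + x ≢ n

-- The mirror image of `LastFlag`: at most one run lies above the previous letter p, and the flag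
-- tells whether there is one.
LastRunFlag : Bool → ℕ → List Run → Set
LastRunFlag false p rs             = All (TopBelow p) rs
LastRunFlag true  p []             = ⊥
LastRunFlag true  p ((l , x) ∷ rs) = p < l × All (TopBelow p) rs

All-consRun : ∀ {P : Run → Set} {l} b {rs} → (∀ {b′} → b ≡ suc b′ → P (l , b′)) → All P rs → All P (consRun l b rs)
All-consRun zero    h ps = ps
All-consRun (suc b) h ps = h ≡.refl ∷ ps

InRuns-consRun⁻ : ∀ {l v} b {rs} → InRuns (consRun l b rs) v → (l ≤ v × v < l + b) ⊎ InRuns rs v
InRuns-consRun⁻         zero    v∈                = inj₂ v∈
InRuns-consRun⁻ {l} {v} (suc b) (here (l≤v , v≤)) = inj₁ (l≤v , ≡.subst (v <_) (≡.sym (+-suc l b)) (s≤s v≤))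
InRuns-consRun⁻         (suc b) (there v∈)        = inj₂ v∈

InRuns-consRunˡ : ∀ {l v} b {rs} → l ≤ v → v < l + b → InRuns (consRun l b rs) v
InRuns-consRunˡ {l} zero    l≤v v<l = contradiction (≡.subst (_ <_) (ℕ.+-identityʳ l) v<l) (≤⇒≯ l≤v)
InRuns-consRunˡ {l} {v} (suc b) l≤v v<  = here (l≤v , ℕ.≤-pred (≡.subst (v <_) (+-suc l b) v<))

InRuns-consRunʳ : ∀ {l v} b {rs} → InRuns rs v → InRuns (consRun l b rs) v
InRuns-consRunʳ zero    v∈ = v∈
InRuns-consRunʳ (suc b) v∈ = there v∈

InRuns-< : ∀ {u rs v} → All (TopBelow u) rs → InRuns rs v → v < u
InRuns-< (top<u ∷ _) (here (_ , v≤)) = ℕ.≤-<-trans v≤ top<u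
InRuns-< (_ ∷ tops)  (there v∈)      = InRuns-< tops v∈

tops-below : ∀ {l rs} → All (λ (l′ , x′) → suc (l′ + x′) < l) rs → All (TopBelow l) rs
tops-below = All.map (λ lt → ℕ.<-trans (ℕ.n<1+n _) lt)

TopBelow-mono : ∀ {u u′ rs} → u ≤ u′ → All (TopBelow u) rs → All (TopBelow u′) rs
TopBelow-mono u≤u′ = All.map (λ lt → ℕ.<-≤-trans lt u≤u′)

erasure-first : ∀ l a b {rs} → All (TopBelow l) rs →
  Erasure (l + b) (InRuns ((l , a + b) ∷ rs)) (InRuns (consRun (suc (l + b)) a (consRun l b rs)))
erasure-first l a b {rs} tops = record
  { split = split ; member = here (ℕ.m≤m+n l b , ℕ.+-monoʳ-≤ l (ℕ.m≤n+m b a)) ; embed = embed ; absent = absent }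
  where
  reassoc : suc (l + (a + b)) ≡ suc (l + b) + a
  reassoc = ≡.cong suc (≡.trans (≡.cong (l +_) (ℕ.+-comm a b)) (≡.sym (ℕ.+-assoc l b a)))

  split : ∀ {v} → InRuns ((l , a + b) ∷ rs) v → v ≢ l + b → InRuns (consRun (suc (l + b)) a (consRun l b rs)) v
  split (there v∈) v≢ = InRuns-consRunʳ a (InRuns-consRunʳ b v∈)
  split {v} (here (l≤v , v≤)) v≢ with v <? l + b
  ... | yes v< = InRuns-consRunʳ a (InRuns-consRunˡ b l≤v v<)
  ... | no v≮  = InRuns-consRunˡ a (≤∧≢⇒< (ℕ.≮⇒≥ v≮) (v≢ ∘ ≡.sym)) (≡.subst (v <_) reassoc (s≤s v≤))

  embed : ∀ {v} → InRuns (consRun (suc (l + b)) a (consRun l b rs)) v → InRuns ((l , a + b) ∷ rs) v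
  embed {v} v∈ with InRuns-consRun⁻ a v∈
  ... | inj₁ (≤v , v<) = here (≤-trans (ℕ.m≤m+n l b) (<⇒≤ ≤v) , ℕ.≤-pred (≡.subst (v <_) (≡.sym reassoc) v<))
  ... | inj₂ v∈′ with InRuns-consRun⁻ b v∈′
  ...   | inj₁ (l≤v , v<) = here (l≤v , ≤-trans (<⇒≤ v<) (ℕ.+-monoʳ-≤ l (ℕ.m≤n+m b a)))
  ...   | inj₂ v∈rs       = there v∈rs

  absent : ¬ InRuns (consRun (suc (l + b)) a (consRun l b rs)) (l + b)
  absent q∈ with InRuns-consRun⁻ a q∈
  ... | inj₁ (q<q , _) = ℕ.<-irrefl ≡.refl q<q
  ... | inj₂ q∈′ with InRuns-consRun⁻ b q∈′
  ...   | inj₁ (_ , q<q) = ℕ.<-irrefl ≡.refl q<q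
  ...   | inj₂ q∈rs      = ≤⇒≯ (ℕ.m≤m+n l b) (InRuns-< tops q∈rs)

erasure-second : ∀ l x l′ x′ {rs} → l′ + x′ < l → All (TopBelow l′) rs →
  Erasure (l′ + x′) (InRuns ((l , x) ∷ (l′ , x′) ∷ rs)) (InRuns ((l , x) ∷ consRun l′ x′ rs))
erasure-second l x l′ x′ {rs} q<l tops = record
  { split  = λ { (here v∈) _ → here v∈ ; (there v∈) v≢q → there (split v∈ v≢q) }
  ; member = there member
  ; embed  = λ { (here v∈) → here v∈ ; (there v∈) → there (embed v∈) }
  ; absent = λ { (here (l≤q , _)) → ≤⇒≯ l≤q q<l ; (there q∈) → absent q∈ }
  }
  -- Taking the top of a run is breaking it with an empty upper piece.
  where open Erasure (erasure-first l′ 0 x′ tops)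

-- If the available values above q lie in one interval of available values, then any c between two
-- of them is available too and must still occur.
arrangement⇒OneRunAbove : ∀ {S q w} l u → (∀ {v} → S v → q < v → l ≤ v × v ≤ u) →
  (∀ {v} → l ≤ v → v ≤ u → S v) → Arrangement S (q ∷ w) → OneRunAbove q w
arrangement⇒OneRunAbove l u above run (arrangement _ sound complete) y c z y∈ c∉ z∈ q<y y<c c<z =
  c∉ (∈-tail (complete (run (≤-trans (proj₁ (above (sound (there y∈)) q<y)) (<⇒≤ y<c))
                            (≤-trans (<⇒≤ c<z) (proj₂ (above (sound (there z∈)) (ℕ.<-trans q<y (ℕ.<-trans y<c c<z)))))))
             (>⇒≢ (ℕ.<-trans q<y y<c)))

first-OneRunAbove : ∀ l x q {rs w} → l ≤ q → All (TopBelow l) rs →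
  Arrangement (InRuns ((l , x) ∷ rs)) (q ∷ w) → OneRunAbove q w
first-OneRunAbove l x q l≤q tops = arrangement⇒OneRunAbove l (l + x)
  (λ { (here v∈) _ → v∈ ; (there v∈) q<v → contradiction (InRuns-< tops v∈) (≤⇒≯ (≤-trans l≤q (<⇒≤ q<v))) })
  (λ l≤v v≤ → here (l≤v , v≤))

second-OneRunAbove : ∀ l x l′ x′ {rs w} → All (TopBelow l′) rs →
  Arrangement (InRuns ((l , x) ∷ (l′ , x′) ∷ rs)) (l′ + x′ ∷ w) → OneRunAbove (l′ + x′) w
second-OneRunAbove l x l′ x′ tops = arrangement⇒OneRunAbove l (l + x)
  (λ { (here v∈) _ → v∈
     ; (there (here (_ , v≤))) q<v → contradiction q<v (≤⇒≯ v≤)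
     ; (there (there v∈)) q<v →
         contradiction (InRuns-< tops v∈) (≤⇒≯ (≤-trans (ℕ.m≤m+n l′ x′) (<⇒≤ q<v))) })
  (λ l≤v v≤ → here (l≤v , v≤))

-- The witnesses are the top of the second run, the value just above it, which no run contains, and
-- the bottom of the first run.
low-inadmissible : ∀ {l x l′ x′ rs q w} → Separated ((l , x) ∷ (l′ , x′) ∷ rs) → q < l′ + x′ →
  Arrangement (InRuns ((l , x) ∷ (l′ , x′) ∷ rs)) (q ∷ w) → ¬ OneRunAbove q w
low-inadmissible {l} {x} {l′} {x′} {rs} {q} {w} ((gap ∷ _) ∷ sep ∷ _) q<y (arrangement _ sound complete) one =
  one (l′ + x′) (suc (l′ + x′)) l
    (∈-tail (complete (there (here (ℕ.m≤m+n l′ x′ , ≤-refl)))) (>⇒≢ q<y))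
    (λ c∈w → gapValue (sound (there c∈w)))
    (∈-tail (complete (here (≤-refl , ℕ.m≤m+n l x))) (>⇒≢ (ℕ.<-trans q<y (ℕ.<-trans (ℕ.n<1+n _) gap))))
    q<y (ℕ.n<1+n _) gap
  where
  gapValue : ¬ InRuns ((l , x) ∷ (l′ , x′) ∷ rs) (suc (l′ + x′))
  gapValue (here (l≤c , _))        = ≤⇒≯ l≤c gap
  gapValue (there (here (_ , c≤))) = ℕ.<-irrefl ≡.refl c≤
  gapValue (there (there c∈))      =
    ≤⇒≯ (≤-trans (ℕ.m≤m+n l′ x′) (ℕ.n≤1+n _)) (InRuns-< (tops-below sep) c∈)

Separated-consRun : ∀ {l rs} b → All (λ (l′ , x′) → suc (l′ + x′) < l) rs → Separated rs → Separated (consRun l b rs)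
Separated-consRun zero    below sep = sep
Separated-consRun (suc b) below sep = below ∷ sep

below-consRun : ∀ {u l rs} b → l + b < u → All (λ (l′ , x′) → suc (l′ + x′) < l) rs →
  All (λ (l′ , x′) → suc (l′ + x′) < u) (consRun l b rs)
below-consRun {u} {l} b l+b<u below = All-consRun b
  (λ { {b′} ≡.refl → ≡.subst (_< u) (+-suc l b′) l+b<u })
  (All.map (λ lt → ℕ.<-trans lt (ℕ.≤-<-trans (ℕ.m≤m+n l b) l+b<u)) below)

tops-consRun : ∀ {l rs} b → All (TopBelow l) rs → All (TopBelow (l + b)) (consRun l b rs)
tops-consRun {l} b tops = All-consRun b
  (λ { {b′} ≡.refl → ℕ.+-monoʳ-< l (ℕ.n<1+n b′) }) (TopBelow-mono (ℕ.m≤m+n l b) tops)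

TopFlag-below : ∀ {n} rs → All (TopBelow n) rs → TopFlag n false rs
TopFlag-below []      []            = ≡.refl
TopFlag-below (_ ∷ _) (top<n ∷ _) = ℕ.<⇒≢ top<n

record RunState (n : ℕ) (z : Bool) (rs : List Run) (d : Bool) (p : ℕ) : Set where
  constructor runState
  field
    separated : Separated rs
    box       : All (TopBelow (suc n)) rs
    topFlag   : TopFlag n z rs
    lastFlag  : LastRunFlag d p rs

state-drop : ∀ {n z l b rs d p} → RunState n z ((l , b) ∷ rs) d p → RunState n false (consRun l b rs) false (l + b)
state-drop {b = b} (runState (below ∷ sep) (top≤n ∷ box) _ _) = runState
  (Separated-consRun b below sep)
  (TopBelow-mono (<⇒≤ top≤n) tops)
  (TopFlag-below _ (TopBelow-mono (ℕ.≤-pred top≤n) tops))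
  tops
  where tops = tops-consRun b (tops-below below)

state-keep : ∀ {n z l x a b rs d p} → suc a + b ≡ x → RunState n z ((l , x) ∷ rs) d p →
  RunState n z ((suc (l + b) , a) ∷ consRun l b rs) true (l + b)
state-keep {n} {z} {l} {x} {a} {b} ≡.refl (runState (below ∷ sep) (top≤n ∷ box) tf _) = runState
  (below-consRun b ≤-refl below ∷ Separated-consRun b below sep)
  (≡.subst (_< suc n) top≡ top≤n ∷ TopBelow-mono (<⇒≤ (ℕ.≤-<-trans (ℕ.+-monoʳ-≤ l (ℕ.m≤n+m b (suc a))) top≤n)) tops)
  (≡.subst (λ u → if z then u ≡ n else u ≢ n) top≡ tf)
  (≤-refl , tops)
  where
  tops = tops-consRun b (tops-below below)
  top≡ : l + (suc a + b) ≡ suc (l + b) + a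
  top≡ = ≡.trans (≡.cong (l +_) (ℕ.+-comm (suc a) b)) (≡.trans (≡.sym (ℕ.+-assoc l b (suc a))) (+-suc (l + b) a))

state-second : ∀ {n z l x l′ x′ rs d p} → RunState n z ((l , x) ∷ (l′ , x′) ∷ rs) d p →
  RunState n z ((l , x) ∷ consRun l′ x′ rs) true (l′ + x′)
state-second {l′ = l′} {x′} (runState ((gap ∷ below) ∷ below′ ∷ sep) (top≤n ∷ top′≤n ∷ box) tf _) = runState
  (below-consRun x′ (ℕ.<-trans (ℕ.n<1+n _) gap) below′ ∷ Separated-consRun x′ below′ sep)
  (top≤n ∷ TopBelow-mono (<⇒≤ top′≤n) tops)
  tf
  (ℕ.<-trans (ℕ.n<1+n _) gap , tops)
  where tops = tops-consRun x′ (tops-below below′)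

run-split : ∀ {l x q} → InRun q (l , x) → ∃ λ a → ∃ λ b → a + b ≡ x × q ≡ l + b
run-split {l} {x} {q} (l≤q , q≤) = x ∸ (q ∸ l) , q ∸ l ,
  ℕ.m∸n+n≡m (ℕ.m≤n+o⇒m∸n≤o q l q≤) , ≡.sym (ℕ.m+[n∸m]≡n l≤q)

-- The run automaton weighs the admissible permutations

module PermWeight {c ℓ : Level} (R : CommutativeSemiring c ℓ)
                  (s t : ℕ → CommutativeSemiring.Carrier R) (n : ℕ) where
  open CommutativeSemiring R hiding (zero) renaming (_+_ to _⊕_; _*_ to _⊗_)
  open Compositions R
  open Transfer R s t
  open Sums R
  open Automata R s t
  open Specs R
  open Spec

  permWeight : ℕ → ℕ → List ℕ → Carrier
  permWeight i p []      = 1#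
  permWeight i p (q ∷ w) =
    (weigh (¬? (q ≟ n) ×-dec ¬? (suc q ∈? w)) (s (suc i)) ⊗ weigh (q <? p) (t i)) ⊗ permWeight (suc i) q w

  antidiag-δ-absent : ∀ l x {q} (g : ℕ → ℕ → Carrier) → (∀ {b} → b ≤ x → q ≢ l + b) →
    antidiag x (λ a b → (q ≡ᵇ l + b) ▸ g a b) ≈ 0#
  antidiag-δ-absent l x {q} g q∉ = trans
    (antidiag-cong-≡ x (λ a b eq → reflexive (≡.cong (_▸ g a b)
      (≢⇒≡ᵇ-false (q∉ (≡.subst (b ≤_) eq (ℕ.m≤n+m b a)))))))
    (antidiag-0 x (λ _ _ → refl))

  antidiag-δ : ∀ l x a b (g : ℕ → ℕ → Carrier) → a + b ≡ x →
    antidiag x (λ a′ b′ → (l + b ≡ᵇ l + b′) ▸ g a′ b′) ≈ g a b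
  antidiag-δ l zero    zero    .0       g ≡.refl rewrite ≡ᵇ-refl (l + 0) = refl
  antidiag-δ l (suc x) zero    .(suc x) g ≡.refl rewrite ≡ᵇ-refl (l + suc x) =
    trans (+-congˡ (antidiag-δ-absent l x (g ∘ suc)
      (λ b≤x eq → ℕ.<⇒≢ (s≤s b≤x) (≡.sym (ℕ.+-cancelˡ-≡ l _ _ eq))))) (+-identityʳ _)
  antidiag-δ l (suc x) (suc a) b        g eq
    rewrite ≢⇒≡ᵇ-false {l + b} {l + suc x}
      (λ eq′ → ℕ.<⇒≢ (s≤s (≡.subst (b ≤_) (ℕ.suc-injective eq) (ℕ.m≤n+m b a))) (ℕ.+-cancelˡ-≡ l _ _ eq′)) =
    trans (+-identityˡ _) (antidiag-δ l x a b (g ∘ suc) (ℕ.suc-injective eq))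

  tWeight-top : ∀ d i {p l x rs q} → InRun q (l , x) → LastRunFlag d p ((l , x) ∷ rs) →
    weigh (q <? p) (t i) ≡ tWeight d i
  tWeight-top true  i {p} {q = q} (l≤q , _) (p<l , _)  = weigh-no (q <? p) (t i) (≤⇒≯ (≤-trans (<⇒≤ p<l) l≤q))
  tWeight-top false i {p} {q = q} (_ , q≤) (top<p ∷ _) = weigh-yes (q <? p) (t i) (ℕ.≤-<-trans q≤ top<p)

  LastRunFlag-second : ∀ d {p l x l′ x′ rs} → LastRunFlag d p ((l , x) ∷ (l′ , x′) ∷ rs) → l′ + x′ < p
  LastRunFlag-second true  (_ , top<p ∷ _) = top<p
  LastRunFlag-second false (_ ∷ top<p ∷ _) = top<p

  sWeight-top : ∀ z i {l x rs w} → TopFlag n z ((l , x) ∷ rs) → suc (l + x) ∉ w →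
    weigh (¬? (l + x ≟ n) ×-dec ¬? (suc (l + x) ∈? w)) (s i) ≡ sWeight z i
  sWeight-top true  i {l} {x} {w = w} top≡n ∉w =
    weigh-no (¬? (l + x ≟ n) ×-dec ¬? (suc (l + x) ∈? w)) (s i) (λ (top≢n , _) → top≢n top≡n)
  sWeight-top false i {l} {x} {w = w} top≢n ∉w =
    weigh-yes (¬? (l + x ≟ n) ×-dec ¬? (suc (l + x) ∈? w)) (s i) (top≢n , ∉w)

  Good : List Run → List ℕ → Set
  Good rs w = Arrangement (InRuns rs) w × PermAdmissible w

  -- Induction on w. A letter of the first run or the top of the second leaves at most one run above
  -- itself; any other available letter leaves two. The value q + 1 is still to come exactly when q
  -- is not the top of its run, which matches the factors s.
  Ψ-spec : ∀ i z rs d p w → RunState n z rs d p → Spec (Good rs w) (Ψ i z rs d w) (permWeight i p w)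
  Ψ-spec i z []             d p []      st = spec (λ _ → refl)
    (λ ¬G → ⊥-elim (¬G (arrangement [] (λ ()) (λ ()) , tt)))
  Ψ-spec i z ((l , x) ∷ rs) d p []      st = spec-0 (λ (arr , _) →
    nil (Arrangement.complete arr (here (≤-refl , ℕ.m≤m+n l x)))) refl
    where
    nil : l ∈ [] → ⊥
    nil ()
  Ψ-spec i z []             d p (q ∷ w) st = spec-0 (λ (arr , _) → nil (Arrangement.sound arr (here ≡.refl))) refl
    where
    nil : InRuns [] q → ⊥
    nil ()
  Ψ-spec i z ((l , x) ∷ rs) d p (q ∷ w) st@(runState sep@(below ∷ _) (top≤n ∷ _) tf lf) = go (l ℕ.≤? q ×-dec q ℕ.≤? l + x)
    where
    Goal : Set ℓ
    Goal = Spec (Good ((l , x) ∷ rs) (q ∷ w)) (Ψ i z ((l , x) ∷ rs) d (q ∷ w)) (permWeight i p (q ∷ w))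

    notSecond : ∀ rs → (∀ {l′ x′ rs′} → rs ≡ (l′ , x′) ∷ rs′ → q ≢ l′ + x′) → Ψ₂ i z (l , x) rs (q ∷ w) ≈ 0#
    notSecond []              _  = refl
    notSecond ((l′ , x′) ∷ rs) q≢ rewrite ≢⇒≡ᵇ-false (q≢ ≡.refl) = refl

    first : InRun q (l , x) → Goal
    first q∈@(l≤q , q≤) with run-split {l} {x} q∈
    ... | a , b , a+b≡x , ≡.refl rewrite tWeight-top d i {rs = rs} q∈ lf = bySplit a a+b≡x
      where
      rest≈0 = notSecond rs (λ { ≡.refl eq →
        ≤⇒≯ (≤-trans l≤q (ℕ.≤-reflexive eq)) (All.head (tops-below below)) })

      select : ∀ a → a + b ≡ x → ∀ {y} → Ψ₁ i z l rs a b w ≈ y → _ ≈ tWeight d i ⊗ y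
      select a a+b≡x eq = trans (+-cong (*-congˡ (trans
        (antidiag-δ l x a b (λ a b → Ψ₁ i z l rs a b w) a+b≡x) eq)) rest≈0) (+-identityʳ _)

      bySplit : ∀ a → a + b ≡ x → _
      bySplit zero    ≡.refl = spec-map
        (λ (arr , _ , ad) → arrangement-tail er arr , ad)
        (λ (arr , ad) → let arr′ = arrangement-cons er arr in arr′ , first-OneRunAbove l x (l + b) l≤q (tops-below below) arr′ , ad)
        (λ (arr , _) eq → trans (select 0 ≡.refl (*-congˡ eq)) (trans (sym (*-assoc _ _ _)) (*-congʳ (trans (*-comm _ _)
          (*-congʳ (reflexive (≡.sym (sWeight-top z (suc i) {l} {b} {rs} tf (next∉ arr)))))))))
        (λ eq → trans (select 0 ≡.refl (trans (*-congˡ eq) (zeroʳ _))) (zeroʳ _))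
        (Ψ-spec (suc i) false (consRun l b rs) false (l + b) w (state-drop st))
        where
        er = erasure-first l 0 b {rs} (tops-below below)
        next∉ : Arrangement (InRuns ((l , b) ∷ rs)) (l + b ∷ w) → suc (l + b) ∉ w
        next∉ arr next∈ with Arrangement.sound arr (there next∈)
        ... | here (_ , q<q) = ℕ.<-irrefl ≡.refl q<q
        ... | there ∈rs      = ≤⇒≯ (≤-trans l≤q (ℕ.n≤1+n _)) (InRuns-< (tops-below below) ∈rs)
      bySplit (suc a) a+b≡x@≡.refl = spec-map
        (λ (arr , _ , ad) → arrangement-tail er arr , ad)
        (λ (arr , ad) → let arr′ = arrangement-cons er arr in arr′ , first-OneRunAbove l x (l + b) l≤q (tops-below below) arr′ , ad)
        (λ (arr , _) eq → trans (select (suc a) ≡.refl eq) (*-congʳ (sym (trans (*-congʳ (reflexive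
          (weigh-no (¬? (l + b ≟ n) ×-dec ¬? (suc (l + b) ∈? w)) (s (suc i)) (λ (_ , ∉w) → ∉w (next∈ arr)))))
          (*-identityˡ _)))))
        (λ eq → trans (select (suc a) ≡.refl eq) (zeroʳ _))
        (Ψ-spec (suc i) z ((suc (l + b) , a) ∷ consRun l b rs) true (l + b) w (state-keep ≡.refl st))
        where
        er = erasure-first l (suc a) b {rs} (tops-below below)
        next∈ : Arrangement (InRuns ((l , suc a + b) ∷ rs)) (l + b ∷ w) → suc (l + b) ∈ w
        next∈ arr = ∈-tail (Arrangement.complete arr (here (m≤n⇒m≤1+n l≤q ,
          ≡.subst (suc (l + b) ≤_) (≡.sym (+-suc l (a + b))) (s≤s (ℕ.+-monoʳ-≤ l (ℕ.m≤n+m b a))))))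
          (>⇒≢ (ℕ.n<1+n _))

    select₂ : ¬ InRun q (l , x) → ∀ {y} → Ψ₂ i z (l , x) rs (q ∷ w) ≈ y → Ψ i z ((l , x) ∷ rs) d (q ∷ w) ≈ y
    select₂ q∉ eq = trans (+-cong (trans (*-congˡ (antidiag-δ-absent l x {q} (λ a b → Ψ₁ i z l rs a b w)
      (λ { {b} b≤x ≡.refl → q∉ (ℕ.m≤m+n l b , ℕ.+-monoʳ-≤ l b≤x) }))) (zeroʳ _)) eq) (+-identityˡ _)

    second : ¬ InRun q (l , x) → ∀ {l′ x′ rs′} → rs ≡ (l′ , x′) ∷ rs′ → q ≡ l′ + x′ → Goal
    second q∉ {l′} {x′} {rs′} ≡.refl ≡.refl = spec-map
        (λ (arr , _ , ad) → arrangement-tail er arr , ad)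
        (λ (arr , ad) → let arr′ = arrangement-cons er arr in arr′ , second-OneRunAbove l x l′ x′ (tops-below below′) arr′ , ad)
        (λ (arr , _) eq → select₂ q∉ (trans pick (trans (*-congˡ eq) (*-congʳ (trans (*-comm _ _) (*-cong
          (reflexive (≡.sym (weigh-yes (¬? (q ≟ n) ×-dec ¬? (suc q ∈? w)) (s (suc i)) (q≢n , next∉ arr))))
          (reflexive (≡.sym (weigh-yes (q <? p) (t i) (LastRunFlag-second d lf))))))))))
        (λ eq → select₂ q∉ (trans pick (trans (*-congˡ eq) (zeroʳ _))))
        (Ψ-spec (suc i) z ((l , x) ∷ consRun l′ x′ rs′) true (l′ + x′) w (state-second st))
      where
      gap : suc q < l
      gap = All.head below
      q<l : q < l
      q<l = ℕ.<-trans (ℕ.n<1+n _) gap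
      below′ = AllPairs.head (AllPairs.tail sep)
      er = erasure-second l x l′ x′ {rs′} q<l (tops-below below′)
      q≢n : q ≢ n
      q≢n = ℕ.<⇒≢ (ℕ.<-≤-trans q<l (≤-trans (ℕ.m≤m+n l x) (ℕ.≤-pred top≤n)))
      pick : Ψ₂ i z (l , x) rs (q ∷ w) ≈ (t i ⊗ s (suc i)) ⊗ Ψ (suc i) z ((l , x) ∷ consRun l′ x′ rs′) true w
      pick rewrite ≡ᵇ-refl (l′ + x′) = refl
      next∉ : Arrangement (InRuns ((l , x) ∷ rs)) (q ∷ w) → suc q ∉ w
      next∉ arr next∈ with Arrangement.sound arr (there next∈)
      ... | here (l≤ , _)          = ≤⇒≯ l≤ gap
      ... | there (here (_ , q<q)) = ℕ.<-irrefl ≡.refl q<q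
      ... | there (there ∈rs)      = ≤⇒≯ (≤-trans (ℕ.m≤m+n l′ x′) (ℕ.n≤1+n _)) (InRuns-< (tops-below below′) ∈rs)

    other : ¬ InRun q (l , x) → (∀ {l′ x′ rs′} → rs ≡ (l′ , x′) ∷ rs′ → q ≢ l′ + x′) → Goal
    other q∉ q≢ = spec-0 (λ (arr , one , _) → bad rs sep q≢ arr one) (select₂ q∉ (notSecond rs q≢))
      where
      bad : ∀ rs → Separated ((l , x) ∷ rs) → (∀ {l′ x′ rs′} → rs ≡ (l′ , x′) ∷ rs′ → q ≢ l′ + x′) →
        Arrangement (InRuns ((l , x) ∷ rs)) (q ∷ w) → ¬ OneRunAbove q w
      bad rs sep q≢ arr with Arrangement.sound arr (here ≡.refl)
      ... | here q∈                     = λ _ → q∉ q∈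
      bad ((l′ , x′) ∷ rs) sep q≢ arr | there (here (_ , q≤)) =
        low-inadmissible sep (≤∧≢⇒< q≤ (q≢ ≡.refl)) arr
      bad ((l′ , x′) ∷ rs) sep@(_ ∷ below′ ∷ _) q≢ arr | there (there q∈) =
        low-inadmissible sep (ℕ.<-≤-trans (InRuns-< (tops-below below′) q∈) (ℕ.m≤m+n l′ x′)) arr

    go : Dec (InRun q (l , x)) → Goal
    go (yes q∈) = first q∈
    go (no q∉)  = go′ rs ≡.refl
      where
      go′ : ∀ rs′ → rs ≡ rs′ → Goal
      go′ []                ≡.refl = other q∉ (λ ())
      go′ ((l′ , x′) ∷ rs′) ≡.refl with q ≟ l′ + x′
      ... | yes q≡top = second q∉ ≡.refl q≡top
      ... | no q≢top  = other q∉ (λ { ≡.refl → q≢top })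

-- From the Boolean tests to permutations and pattern avoidance

∈-range : ∀ {a b v} → a ≤ v → v ≤ b → v ∈ range a b
∈-range {a} {b} {v} a≤v v≤b rewrite range≡iterate a b = go a (suc b ∸ a) a≤v
  (≡.subst (v <_) (≡.sym (m+[n∸m]≡n (m≤n⇒m≤1+n (≤-trans a≤v v≤b)))) (s≤s v≤b))
  where
  go : ∀ a k → a ≤ v → v < a + k → v ∈ iterate suc a k
  go a zero    a≤v v<a = contradiction (≡.subst (v <_) (ℕ.+-identityʳ a) v<a) (≤⇒≯ a≤v)
  go a (suc k) a≤v v<a+k with v ≟ a
  ... | yes v≡a = here v≡a
  ... | no v≢a  = there (go (suc a) k (≤∧≢⇒< a≤v (v≢a ∘ ≡.sym)) (≡.subst (v <_) (+-suc a k) v<a+k))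

any-range⁺ : ∀ (p : ℕ → Bool) {a b v} → a ≤ v → v ≤ b → T (p v) → T (any p (range a b))
any-range⁺ p a≤v v≤b pv = any⁺ p (lose (∈-range a≤v v≤b) pv)

any-range⁻ : ∀ (p : ℕ → Bool) {a b} → T (any p (range a b)) → ∃ λ v → a ≤ v × v ≤ b × T (p v)
any-range⁻ p {a} {b} h with find (any⁻ p (range a b) h)
... | v , v∈ , pv with All.lookup (All-range a b) v∈
...   | a≤v , v≤b = v , a≤v , v≤b , pv

all-range⁺ : ∀ (p : ℕ → Bool) {a b} → (∀ {v} → a ≤ v → v ≤ b → T (p v)) → T (all p (range a b))
all-range⁺ p {a} {b} h = Allₚ.all⁻ p (All.map (λ (a≤v , v≤b) → h a≤v v≤b) (All-range a b))

all-range⁻ : ∀ (p : ℕ → Bool) {a b v} → T (all p (range a b)) → a ≤ v → v ≤ b → T (p v)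
all-range⁻ p {a} {b} h a≤v v≤b = All.lookup (Allₚ.all⁺ p (range a b) h) (∈-range a≤v v≤b)

T-not⁺ : ∀ {b} → ¬ T b → T (not b)
T-not⁺ {true}  h = h tt
T-not⁺ {false} h = tt

T-not⁻ : ∀ {b} → T (not b) → ¬ T b
T-not⁻ {false} _ ()

≡does : ∀ {A : Set} {b} (a? : Dec A) → (T b → A) → (A → T b) → b ≡ does a?
≡does {b = true}  a? to from = ≡.sym (dec-true a? (to tt))
≡does {b = false} a? to from = ≡.sym (dec-false a? from)

at-middle : ∀ pre x post → at (pre ++ x ∷ post) (suc (length pre)) ≡ x
at-middle []        x post = ≡.refl
at-middle (_ ∷ pre) x post = at-middle pre x post

at-next : ∀ pre x y post → at (pre ++ x ∷ y ∷ post) (suc (suc (length pre))) ≡ y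
at-next []        x y post = ≡.refl
at-next (_ ∷ pre) x y post = at-next pre x y post

split-at : ∀ e j → 1 ≤ j → j ≤ length e → ∃₂ λ pre post → e ≡ pre ++ at e j ∷ post × suc (length pre) ≡ j
split-at (x ∷ e) (suc zero)    _ _           = [] , e , ≡.refl , ≡.refl
split-at (x ∷ e) (suc (suc j)) _ (s≤s j≤) with split-at e (suc j) (s≤s z≤n) j≤
... | pre , post , eq , len = x ∷ pre , post , ≡.cong (x ∷_) eq , ≡.cong suc len

at-∈-suffix : ∀ pre post {k} → length pre < k → k ≤ length (pre ++ post) → at (pre ++ post) k ∈ post
at-∈-suffix []        (x ∷ post) {suc zero}    _ _        = here ≡.refl
at-∈-suffix []        (x ∷ post) {suc (suc k)} _ (s≤s k≤) = there (at-∈-suffix [] post (s≤s z≤n) k≤)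
at-∈-suffix (_ ∷ pre) post       {suc (suc k)} (s≤s <k) (s≤s k≤) = at-∈-suffix pre post <k k≤

∈-suffix-at : ∀ pre post {v} → v ∈ post → ∃ λ k → length pre < k × k ≤ length (pre ++ post) × at (pre ++ post) k ≡ v
∈-suffix-at [] (x ∷ post) (here ≡.refl) = 1 , s≤s z≤n , s≤s z≤n , ≡.refl
∈-suffix-at [] (x ∷ post) (there v∈) with ∈-suffix-at [] post v∈
... | suc k , _ , k≤ , eq = suc (suc k) , s≤s z≤n , s≤s k≤ , eq
∈-suffix-at (_ ∷ pre) post v∈ with ∈-suffix-at pre post v∈
... | suc k , <k , k≤ , eq = suc (suc k) , s≤s <k , s≤s k≤ , eq

at-∈-prefix : ∀ pre post {k} → 1 ≤ k → k ≤ length pre → at (pre ++ post) k ∈ pre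
at-∈-prefix (x ∷ pre) post {suc zero}    _ _        = here ≡.refl
at-∈-prefix (x ∷ pre) post {suc (suc k)} _ (s≤s k≤) = there (at-∈-prefix pre post (s≤s z≤n) k≤)

∈-prefix-at : ∀ pre post {v} → v ∈ pre → ∃ λ k → 1 ≤ k × k ≤ length pre × at (pre ++ post) k ≡ v
∈-prefix-at (x ∷ pre) post (here ≡.refl) = 1 , s≤s z≤n , s≤s z≤n , ≡.refl
∈-prefix-at (x ∷ pre) post (there v∈) with ∈-prefix-at pre post v∈
... | suc k , _ , k≤ , eq = suc (suc k) , s≤s z≤n , s≤s k≤ , eq

unique-++-disjoint : ∀ pre {post} {v : ℕ} → Unique (pre ++ post) → v ∈ pre → v ∉ post
unique-++-disjoint (x ∷ pre) (x∉ ∷ _)    (here ≡.refl) v∈post = All.lookup x∉ (∈-++⁺ʳ pre v∈post) ≡.refl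
unique-++-disjoint (x ∷ pre) (_ ∷ uniq) (there v∈)    v∈post = unique-++-disjoint pre uniq v∈ v∈post

unique-⊆-length : ∀ {xs ys : List ℕ} → Unique xs → (∀ {v} → v ∈ xs → v ∈ ys) → length xs ≤ length ys
unique-⊆-length {[]}     _            _   = z≤n
unique-⊆-length {x ∷ xs} (x∉ ∷ uniq) sub with ∈-∃++ (sub (here ≡.refl))
... | ys , zs , ≡.refl = ≡.subst (suc (length xs) ≤_) len (s≤s (unique-⊆-length uniq sub′))
  where
  len : suc (length (ys ++ zs)) ≡ length (ys ++ x ∷ zs)
  len = ≡.trans (≡.cong suc (length-++ ys)) (≡.trans (≡.sym (+-suc (length ys) (length zs))) (≡.sym (length-++ ys)))
  sub′ : ∀ {v} → v ∈ xs → v ∈ ys ++ zs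
  sub′ v∈ with ∈-++⁻ ys (sub (there v∈))
  ... | inj₁ v∈ys           = ∈-++⁺ˡ v∈ys
  ... | inj₂ (here ≡.refl)  = contradiction ≡.refl (All.lookup x∉ v∈)
  ... | inj₂ (there v∈zs)   = ∈-++⁺ʳ ys v∈zs

-- Pigeonhole: if q recurs, the list without this occurrence still covers `xs` but is shorter. This
-- supplies distinctness, since `isPerm` only tests that every value occurs.
unique-cover : ∀ {xs} → Unique xs → ∀ pre w → length (pre ++ w) ≤ length xs → (∀ {v} → v ∈ xs → v ∈ pre ++ w) → Unique w
unique-cover uniq pre []      len sub = []
unique-cover {xs} uniq pre (q ∷ w) len sub =
  All.tabulate (λ { v∈w ≡.refl → ℕ.<-irrefl ≡.refl (≤-trans (ℕ.≤-trans (s≤s (unique-⊆-length uniq (sub′ v∈w))) len′) len) })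
  ∷ unique-cover uniq (pre ∷ʳ q) w (≡.subst (λ l → length l ≤ length xs) shift len) (≡.subst (_ ∈_) shift ∘ sub)
  where
  shift : pre ++ q ∷ w ≡ (pre ∷ʳ q) ++ w
  shift = ≡.sym (++-assoc pre [ q ] w)
  len′ : suc (length (pre ++ w)) ≤ length (pre ++ q ∷ w)
  len′ = ℕ.≤-reflexive (≡.trans (≡.cong suc (length-++ pre))
    (≡.trans (≡.sym (+-suc (length pre) (length w))) (≡.sym (length-++ pre))))
  sub′ : q ∈ w → ∀ {v} → v ∈ xs → v ∈ pre ++ w
  sub′ q∈w v∈ with ∈-++⁻ pre (sub v∈)
  ... | inj₁ v∈pre          = ∈-++⁺ˡ v∈pre
  ... | inj₂ (here ≡.refl)  = ∈-++⁺ʳ pre q∈w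
  ... | inj₂ (there v∈w)    = ∈-++⁺ʳ pre v∈w

length-iterate : ∀ a k → length (iterate suc a k) ≡ k
length-iterate a zero    = ≡.refl
length-iterate a (suc k) = ≡.cong suc (length-iterate (suc a) k)

unique-iterate : ∀ a k → Unique (iterate suc a k)
unique-iterate a zero    = []
unique-iterate a (suc k) = All.map (λ (a<v , _) → ℕ.<⇒≢ a<v) (All-iterate (suc a) k) ∷ unique-iterate (suc a) k

words-box : ∀ m n → All (λ w → length w ≡ m × All (λ v → 1 ≤ v × v ≤ n) w) (words m n)
words-box zero    n = (≡.refl , []) ∷ []
words-box (suc m) n = All-concatMap (λ w → map (_∷ w) (range 1 n))
  (λ (len , box) → Allₚ.map⁺ (All.map (λ q∈ → ≡.cong suc len , q∈ ∷ box) (All-range 1 n))) (words-box m n)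

suffixes-length : ∀ i m → All (λ e → length e ≡ m) (suffixes i m)
suffixes-length i zero    = ≡.refl ∷ []
suffixes-length i (suc m) = All-concatMap (λ e → map (_∷ e) (range 0 i))
  (λ len → Allₚ.map⁺ (All.universal (λ _ → ≡.cong suc len) (range 0 i))) (suffixes-length (suc i) m)

Interval : ℕ → ℕ → Set
Interval n v = 1 ≤ v × v ≤ n

isPerm⁻ : ∀ {n w} → length w ≡ n → All (Interval n) w → T (isPerm n w) → Arrangement (Interval n) w
isPerm⁻ {n} {w} len box perm = arrangement
  (unique-cover (unique-iterate 1 n) [] w (ℕ.≤-reflexive (≡.trans len (≡.sym (length-iterate 1 n))))
    (λ v∈ → let 1≤v , v<1+n = All.lookup (All-iterate 1 n) v∈ in cover 1≤v (ℕ.≤-pred v<1+n)))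
  (All.lookup box)
  (λ (1≤v , v≤n) → cover 1≤v v≤n)
  where
  cover : ∀ {v} → 1 ≤ v → v ≤ n → v ∈ w
  cover {v} 1≤v v≤n with find (any⁻ (_≡ᵇ v) w (all-range⁻ (λ v → any (_≡ᵇ v) w) perm 1≤v v≤n))
  ... | x , x∈w , x≡v = ≡.subst (_∈ w) (≡ᵇ⇒≡ x v x≡v) x∈w

isPerm⁺ : ∀ {n w} → Arrangement (Interval n) w → T (isPerm n w)
isPerm⁺ {n} {w} arr = all-range⁺ (λ v → any (_≡ᵇ v) w)
  (λ {v} 1≤v v≤n → any⁺ (_≡ᵇ v) (lose (Arrangement.complete arr (1≤v , v≤n)) (≡⇒≡ᵇ v v ≡.refl)))

Ordered4 : ℕ → ℕ → ℕ → ℕ → ℕ → Set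
Ordered4 n i j k l = 1 ≤ i × i < j × j < k × k < l × l ≤ n

-- The common shape of `contains3142` and `contains3124`, both of which are instances by definition.
anyQuadruple : ℕ → (ℕ → ℕ → ℕ → ℕ → Bool) → Bool
anyQuadruple n f = any (λ i → any (λ j → any (λ k → any (f i j k)
  (range (suc k) n)) (range (suc j) n)) (range (suc i) n)) (range 1 n)

anyQuadruple⁺ : ∀ {n} f {i j k l} → Ordered4 n i j k l → T (f i j k l) → T (anyQuadruple n f)
anyQuadruple⁺ f (1≤i , i<j , j<k , k<l , l≤n) h =
  any-range⁺ _ 1≤i (≤-trans (<⇒≤ i<j) j≤n) (any-range⁺ _ i<j j≤n (any-range⁺ _ j<k k≤n (any-range⁺ _ k<l l≤n h)))
  where
  k≤n = ≤-trans (<⇒≤ k<l) l≤n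
  j≤n = ≤-trans (<⇒≤ j<k) k≤n

anyQuadruple⁻ : ∀ {n} f → T (anyQuadruple n f) → ∃₂ λ i j → ∃₂ λ k l → Ordered4 n i j k l × T (f i j k l)
anyQuadruple⁻ {n} f h with any-range⁻ _ {1} {n} h
... | i , 1≤i , _ , h₁ with any-range⁻ _ {suc i} {n} h₁
... | j , i<j , _ , h₂ with any-range⁻ _ {suc j} {n} h₂
... | k , j<k , _ , h₃ with any-range⁻ _ {suc k} {n} h₃
... | l , k<l , l≤n , h₄ = i , j , k , l , (1≤i , i<j , j<k , k<l , l≤n) , h₄

increasing⁺ : ∀ {a b c d} → a < b → b < c → c < d → T ((a <ᵇ b) ∧ (b <ᵇ c) ∧ (c <ᵇ d))
increasing⁺ p q r = Equivalence.from T-∧ (<⇒<ᵇ p , Equivalence.from T-∧ (<⇒<ᵇ q , <⇒<ᵇ r))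

increasing⁻ : ∀ {a b c d} → T ((a <ᵇ b) ∧ (b <ᵇ c) ∧ (c <ᵇ d)) → a < b × b < c × c < d
increasing⁻ h with Equivalence.to T-∧ h
... | p , qr with Equivalence.to T-∧ qr
... | q , r = <ᵇ⇒< _ _ p , <ᵇ⇒< _ _ q , <ᵇ⇒< _ _ r

containsGeNeGe⁺ : ∀ {n} e i j k → 1 ≤ i → i < j → j < k → k ≤ n →
  at e j ≤ at e i → at e j ≢ at e k → at e k ≤ at e i → T (containsGeNeGe n e)
containsGeNeGe⁺ e i j k 1≤i i<j j<k k≤n p q r =
  any-range⁺ _ 1≤i (≤-trans (<⇒≤ i<j) j≤n) (any-range⁺ _ i<j j≤n (any-range⁺ _ j<k k≤n
    (Equivalence.from T-∧ (≤⇒≤ᵇ p , Equivalence.from T-∧ (T-not⁺ (q ∘ ≡ᵇ⇒≡ _ _) , ≤⇒≤ᵇ r)))))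
  where j≤n = ≤-trans (<⇒≤ j<k) k≤n

containsGeNeGe⁻ : ∀ {n} e → T (containsGeNeGe n e) → ∃ λ i → ∃₂ λ j k → (1 ≤ i × i < j × j < k × k ≤ n) ×
  at e j ≤ at e i × at e j ≢ at e k × at e k ≤ at e i
containsGeNeGe⁻ {n} e h with any-range⁻ _ {1} {n} h
... | i , 1≤i , _ , h₁ with any-range⁻ _ {suc i} {n} h₁
... | j , i<j , _ , h₂ with any-range⁻ _ {suc j} {n} h₂
... | k , j<k , k≤n , h₃ with Equivalence.to T-∧ h₃
... | p , qr with Equivalence.to T-∧ qr
... | q , r = i , j , k , (1≤i , i<j , j<k , k≤n) , ≤ᵇ⇒≤ _ _ p , T-not⁻ q ∘ ≡⇒≡ᵇ _ _ , ≤ᵇ⇒≤ _ _ r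

Admissible⁺ : ∀ e → (∀ pre x post → e ≡ pre ++ x ∷ post → AtMostOneBelow x post) → Admissible e
Admissible⁺ []      h = tt
Admissible⁺ (x ∷ e) h = h [] x e ≡.refl , Admissible⁺ e (λ pre y post eq → h (x ∷ pre) y post (≡.cong (x ∷_) eq))

Admissible⁻ : ∀ pre {x post} → Admissible (pre ++ x ∷ post) → AtMostOneBelow x post
Admissible⁻ []        (h , _)  = h
Admissible⁻ (_ ∷ pre) (_ , ad) = Admissible⁻ pre ad

PermAdmissible⁺ : ∀ w → (∀ pre q post → w ≡ pre ++ q ∷ post → OneRunAbove q post) → PermAdmissible w
PermAdmissible⁺ []      h = tt
PermAdmissible⁺ (q ∷ w) h = h [] q w ≡.refl , PermAdmissible⁺ w (λ pre y post eq → h (q ∷ pre) y post (≡.cong (q ∷_) eq))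

PermAdmissible⁻ : ∀ pre {q post} → PermAdmissible (pre ++ q ∷ post) → OneRunAbove q post
PermAdmissible⁻ []        (h , _)  = h
PermAdmissible⁻ (_ ∷ pre) (_ , ad) = PermAdmissible⁻ pre ad

at-later : ∀ pre {x : ℕ} post {k} → suc (length pre) < k → k ≤ length (pre ++ x ∷ post) → at (pre ++ x ∷ post) k ∈ post
at-later pre {x} post {k} <k k≤ = ≡.subst (λ l → at l k ∈ post) shift
  (at-∈-suffix (pre ∷ʳ x) post (≡.subst (_< k) (≡.sym (length-∷ʳ pre x)) <k) (≡.subst (λ l → k ≤ length l) (≡.sym shift) k≤))
  where shift = ++-assoc pre [ x ] post

later-at : ∀ pre {x : ℕ} post {v} → v ∈ post →
  ∃ λ k → suc (length pre) < k × k ≤ length (pre ++ x ∷ post) × at (pre ++ x ∷ post) k ≡ v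
later-at pre {x} post v∈ with ∈-suffix-at (pre ∷ʳ x) post v∈
... | k , <k , k≤ , eq = k , ≡.subst (_< k) (length-∷ʳ pre x) <k ,
  ≡.subst (λ l → k ≤ length l) shift k≤ , ≡.trans (≡.cong (λ l → at l k) (≡.sym shift)) eq
  where shift = ++-assoc pre [ x ] post

avoids⇒Admissible : ∀ e → ¬ T (containsGeNeGe (length e) e) → Admissible e
avoids⇒Admissible e avoid = Admissible⁺ e below
  where
  below : ∀ pre x post → e ≡ pre ++ x ∷ post → AtMostOneBelow x post
  below pre x post ≡.refl y z y∈ z∈ y≤x z≤x with y ≟ z
  ... | yes y≡z = y≡z
  ... | no y≢z with later-at pre {x} post y∈ | later-at pre {x} post z∈
  ... | j , <j , j≤ , ≡.refl | k , <k , k≤ , ≡.refl = contradiction occurrence avoid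
    where
    ≤x : ∀ {v} → v ≤ x → v ≤ at e (suc (length pre))
    ≤x = ≡.subst (_ ≤_) (≡.sym (at-middle pre x post))
    occurrence : T (containsGeNeGe (length e) e)
    occurrence with ℕ.<-cmp j k
    ... | tri< j<k _ _ = containsGeNeGe⁺ e _ j k (s≤s z≤n) <j j<k k≤ (≤x y≤x) y≢z (≤x z≤x)
    ... | tri≈ _ ≡.refl _ = contradiction ≡.refl y≢z
    ... | tri> _ _ k<j = containsGeNeGe⁺ e _ k j (s≤s z≤n) <k k<j j≤ (≤x z≤x) (y≢z ∘ ≡.sym) (≤x y≤x)

Admissible⇒avoids : ∀ e → Admissible e → ¬ T (containsGeNeGe (length e) e)
Admissible⇒avoids e ad h with containsGeNeGe⁻ {length e} e h
... | i , j , k , (1≤i , i<j , j<k , k≤n) , p , q , r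
  with split-at e i 1≤i (≤-trans (<⇒≤ i<j) (≤-trans (<⇒≤ j<k) k≤n))
... | pre , post , eq , ≡.refl = q (Admissible⁻ pre (≡.subst Admissible eq ad) _ _
    (later i<j (≤-trans (<⇒≤ j<k) k≤n)) (later (ℕ.<-trans i<j j<k) k≤n) p r)
  where
  later : ∀ {m} → suc (length pre) < m → m ≤ length e → at e m ∈ post
  later {m} <m m≤ = ≡.subst (λ l → at l m ∈ post) (≡.sym eq)
    (at-later pre post <m (≡.subst (λ l → m ≤ length l) eq m≤))

-- A value c that exceeds q and does not follow it must precede it. Then c, q, y, z are the 3, 1, 2,
-- 4 of a 3124 if y comes before z, and of a 3142 otherwise.
avoids⇒PermAdmissible : ∀ π → Arrangement (Interval (length π)) π →
  ¬ T (contains3142 (length π) π ∨ contains3124 (length π) π) → PermAdmissible π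
avoids⇒PermAdmissible π arr avoid = PermAdmissible⁺ π oneRun
  where
  oneRun : ∀ pre q post → π ≡ pre ++ q ∷ post → OneRunAbove q post
  oneRun pre q post ≡.refl y c z y∈ c∉ z∈ q<y y<c c<z
    with later-at pre {q} post y∈ | later-at pre {q} post z∈
       | ∈-prefix-at pre (q ∷ post) c∈pre
    where
    c∈ : c ∈ π
    c∈ = Arrangement.complete arr (≤-trans (s≤s z≤n) y<c ,
      ≤-trans (<⇒≤ c<z) (proj₂ (Arrangement.sound arr (∈-++⁺ʳ pre (there z∈)))))
    c∈pre : c ∈ pre
    c∈pre with ∈-++⁻ pre c∈
    ... | inj₁ c∈pre          = c∈pre
    ... | inj₂ (here ≡.refl)  = contradiction (ℕ.<-trans q<y y<c) (ℕ.<-irrefl ≡.refl)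
    ... | inj₂ (there c∈post) = contradiction c∈post c∉
  ... | k , <k , k≤ , ≡.refl | l , <l , l≤ , ≡.refl | i , 1≤i , i≤ , ≡.refl = avoid occurrence
    where
    q< : at π (suc (length pre)) < y
    q< = ≡.subst (_< y) (≡.sym (at-middle pre q post)) q<y
    occurrence : T (contains3142 (length π) π ∨ contains3124 (length π) π)
    occurrence with ℕ.<-cmp k l
    ... | tri< k<l _ _ = Equivalence.from T-∨ (inj₂ (anyQuadruple⁺ {length π} _ {i} {suc (length pre)} {k} {l}
      (1≤i , s≤s i≤ , <k , k<l , l≤) (increasing⁺ q< y<c c<z)))
    ... | tri≈ _ ≡.refl _ = contradiction (ℕ.<-trans y<c c<z) (ℕ.<-irrefl ≡.refl)
    ... | tri> _ _ l<k = Equivalence.from T-∨ (inj₁ (anyQuadruple⁺ {length π} _ {i} {suc (length pre)} {l} {k}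
      (1≤i , s≤s i≤ , <l , l<k , k≤) (increasing⁺ q< y<c c<z)))

-- In both patterns the 3 precedes the 1, and the 2 and the 4 follow in some order; `bad` leaves
-- that order open.
PermAdmissible⇒avoids : ∀ π → Unique π → PermAdmissible π →
  ¬ T (contains3142 (length π) π ∨ contains3124 (length π) π)
PermAdmissible⇒avoids π uniq ad h = [ case₁ ∘ anyQuadruple⁻ {length π} _ , case₂ ∘ anyQuadruple⁻ {length π} _ ]′ (Equivalence.to T-∨ h)
  where
  bad : ∀ {i j k l} → 1 ≤ i → i < j → j < k → k ≤ length π → j < l → l ≤ length π →
    at π j < at π k → at π k < at π i → ¬ at π i < at π l
  bad {i} {j} {k} {l} 1≤i i<j j<k k≤ j<l l≤ p q r with split-at π j (≤-trans 1≤i (<⇒≤ i<j)) (≤-trans (<⇒≤ j<k) k≤)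
  ... | pre , post , eq , ≡.refl = PermAdmissible⁻ pre (≡.subst PermAdmissible eq ad) _ _ _
      (later j<k k≤) (λ c∈ → unique-++-disjoint pre (≡.subst Unique eq uniq) earlier (there c∈)) (later j<l l≤) p q r
    where
    later : ∀ {m} → suc (length pre) < m → m ≤ length π → at π m ∈ post
    later {m} <m m≤ = ≡.subst (λ l → at l m ∈ post) (≡.sym eq)
      (at-later pre post <m (≡.subst (λ l → m ≤ length l) eq m≤))
    earlier : at π i ∈ pre
    earlier = ≡.subst (λ l → at l i ∈ pre) (≡.sym eq) (at-∈-prefix pre _ 1≤i (ℕ.≤-pred i<j))

  case₁ : _ → ⊥
  case₁ (i , j , k , l , (1≤i , i<j , j<k , k<l , l≤) , h) with increasing⁻ h
  ... | p , q , r = bad 1≤i i<j (ℕ.<-trans j<k k<l) l≤ j<k (≤-trans (<⇒≤ k<l) l≤) p q r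

  case₂ : _ → ⊥
  case₂ (i , j , k , l , (1≤i , i<j , j<k , k<l , l≤) , h) with increasing⁻ h
  ... | p , q , r = bad 1≤i i<j j<k (≤-trans (<⇒≤ k<l) l≤) (ℕ.<-trans j<k k<l) l≤ p q r

-- The statistics seen from the letter and what follows it

vidTest : List ℕ → ℕ → Bool
vidTest π i = any (λ j → at π j ≡ᵇ suc (at π i)) (range 1 (i ∸ 1))

distTest : ℕ → List ℕ → ℕ → Bool
distTest n e i = (at e i ≠ᵇ 0) ∧ all (λ j → at e i ≠ᵇ at e j) (range (suc i) n)

-- Every value up to n occurs exactly once, so q + 1 stands to the left exactly when it is at most n
-- and does not stand to the right.
vidTest-suffix : ∀ {n} pre q post → Arrangement (Interval n) (pre ++ q ∷ post) →
  vidTest (pre ++ q ∷ post) (suc (length pre)) ≡ does (¬? (q ≟ n) ×-dec ¬? (suc q ∈? post))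
vidTest-suffix {n} pre q post arr rewrite at-middle pre q post =
  ≡does (¬? (q ≟ n) ×-dec ¬? (suc q ∈? post)) to from
  where
  open Arrangement arr
  π = pre ++ q ∷ post

  to : T (any (λ j → at π j ≡ᵇ suc q) (range 1 (length pre))) → q ≢ n × suc q ∉ post
  to h with any-range⁻ (λ j → at π j ≡ᵇ suc q) {1} {length pre} h
  ... | j , 1≤j , j≤ , eq = (λ { ≡.refl → ℕ.<-irrefl ≡.refl (proj₂ (sound (∈-++⁺ˡ next∈))) }) ,
                            (λ next∈post → unique-++-disjoint pre unique next∈ (there next∈post))
    where
    next∈ : suc q ∈ pre
    next∈ = ≡.subst (_∈ pre) (≡ᵇ⇒≡ _ _ eq) (at-∈-prefix pre (q ∷ post) 1≤j j≤)

  from : q ≢ n × suc q ∉ post → T (any (λ j → at π j ≡ᵇ suc q) (range 1 (length pre)))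
  from (q≢n , next∉post) with ∈-prefix-at pre (q ∷ post) next∈
    where
    next∈ : suc q ∈ pre
    next∈ with ∈-++⁻ pre (complete (s≤s z≤n , ≤∧≢⇒< (proj₂ (sound (∈-++⁺ʳ pre (here ≡.refl)))) q≢n))
    ... | inj₁ next∈pre          = next∈pre
    ... | inj₂ (there next∈post) = contradiction next∈post next∉post
  ... | k , 1≤k , k≤ , eq = any-range⁺ (λ j → at π j ≡ᵇ suc q) 1≤k k≤ (≡⇒≡ᵇ (at π k) (suc q) eq)

distTest-suffix : ∀ pre x post → distTest (length (pre ++ x ∷ post)) (pre ++ x ∷ post) (suc (length pre))
  ≡ does (¬? (x ≟ 0) ×-dec ¬? (x ∈? post))
distTest-suffix pre x post rewrite at-middle pre x post = ≡does (¬? (x ≟ 0) ×-dec ¬? (x ∈? post)) to from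
  where
  e = pre ++ x ∷ post
  rest = all (λ j → x ≠ᵇ at e j) (range (suc (suc (length pre))) (length e))

  to : T ((x ≠ᵇ 0) ∧ rest) → x ≢ 0 × x ∉ post
  to h with Equivalence.to (T-∧ {x ≠ᵇ 0} {rest}) h
  ... | h₀ , h₁ = T-not⁻ h₀ ∘ ≡⇒≡ᵇ x 0 , new
    where
    new : x ∉ post
    new x∈ with later-at pre {x} post x∈
    ... | k , <k , k≤ , eq = T-not⁻ (all-range⁻ (λ j → x ≠ᵇ at e j) h₁ <k k≤) (≡⇒≡ᵇ x (at e k) (≡.sym eq))

  from : x ≢ 0 × x ∉ post → T ((x ≠ᵇ 0) ∧ rest)
  from (x≢0 , x∉) = Equivalence.from (T-∧ {x ≠ᵇ 0} {rest}) (T-not⁺ (x≢0 ∘ ≡ᵇ⇒≡ x 0) ,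
    all-range⁺ (λ j → x ≠ᵇ at e j) (λ {v} <v v≤ → T-not⁺ (λ eq →
      x∉ (≡.subst (_∈ post) (≡.sym (≡ᵇ⇒≡ x (at e v) eq)) (at-later pre post <v v≤)))))

-- Position 1 is excluded from both statistics but would fail the tests anyway: nothing stands to
-- its left, and an inversion sequence starts with 0. So positions can be counted from 1, in step
-- with the letters.
filterᵇ-skip : ∀ (v : ℕ → Bool) n → v 1 ≡ false →
  filterᵇ v (range 2 (suc n)) ≡ filterᵇ v (iterate suc 1 (suc n))
filterᵇ-skip v n eq rewrite range≡iterate 2 (suc n) | eq = ≡.refl

-- Monomials as letterwise weights, and the final comparison

module Main {c ℓ : Level} (R : CommutativeSemiring c ℓ)
            (s t : ℕ → CommutativeSemiring.Carrier R) where
  open CommutativeSemiring R hiding (zero) renaming (_+_ to _⊕_; _*_ to _⊗_)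
  open SetoidReasoning setoid
  open CSemigroup *-commutativeSemigroup using (interchange)
  open Compositions R
  open Transfer R s t
  open Sums R
  open Automata R s t
  open InvSeqWeight R s t
  open Specs R
  open PermWeight R s t
  open Spec

  perLetter : (ℕ → List ℕ → Bool) → (ℕ → Carrier) → ℕ → List ℕ → Carrier
  perLetter D x i []      = 1#
  perLetter D x i (q ∷ w) = (if D q w then x (suc i) else 1#) ⊗ perLetter D x (suc i) w

  perStep : (ℕ → ℕ → Bool) → (ℕ → Carrier) → ℕ → ℕ → List ℕ → Carrier
  perStep E x i p []      = 1#
  perStep E x i p (q ∷ w) = (if E p q then x i else 1#) ⊗ perStep E x (suc i) q w

  monomial-∷ : ∀ x (v : ℕ → Bool) i is →
    monomial R x (filterᵇ v (i ∷ is)) ≈ (if v i then x i else 1#) ⊗ monomial R x (filterᵇ v is)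
  monomial-∷ x v i is with v i
  ... | true  = refl
  ... | false = sym (*-identityˡ _)

  monomial-perLetter : ∀ x v D e pre suf → e ≡ pre ++ suf →
    (∀ pre q post → e ≡ pre ++ q ∷ post → v (suc (length pre)) ≡ D q post) →
    monomial R x (filterᵇ v (iterate suc (suc (length pre)) (length suf))) ≈ perLetter D x (length pre) suf
  monomial-perLetter x v D e pre []        eq h = refl
  monomial-perLetter x v D e pre (q ∷ suf) eq h = begin
    monomial R x (filterᵇ v (suc (length pre) ∷ iterate suc (suc (suc (length pre))) (length suf)))
      ≈⟨ monomial-∷ x v (suc (length pre)) _ ⟩
    (if v (suc (length pre)) then x (suc (length pre)) else 1#) ⊗ monomial R x (filterᵇ v (iterate suc (suc (suc (length pre))) (length suf)))
      ≈⟨ *-cong (reflexive (≡.cong (if_then x (suc (length pre)) else 1#) (h pre q suf eq)))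
           (≡.subst (λ k → monomial R x (filterᵇ v (iterate suc (suc k) (length suf))) ≈ perLetter D x k suf)
             (length-∷ʳ pre q)
             (monomial-perLetter x v D e (pre ∷ʳ q) suf (≡.trans eq (≡.sym (++-assoc pre [ q ] suf))) h)) ⟩
    perLetter D x (length pre) (q ∷ suf) ∎

  monomial-perStep : ∀ x v E e pre p suf → e ≡ pre ++ p ∷ suf → (∀ i → v i ≡ E (at e i) (at e (suc i))) →
    monomial R x (filterᵇ v (iterate suc (suc (length pre)) (length suf))) ≈ perStep E x (suc (length pre)) p suf
  monomial-perStep x v E e pre p []        eq h = refl
  monomial-perStep x v E e pre p (q ∷ suf) eq h = begin
    monomial R x (filterᵇ v (suc (length pre) ∷ iterate suc (suc (suc (length pre))) (length suf)))
      ≈⟨ monomial-∷ x v (suc (length pre)) _ ⟩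
    (if v (suc (length pre)) then x (suc (length pre)) else 1#) ⊗ monomial R x (filterᵇ v (iterate suc (suc (suc (length pre))) (length suf)))
      ≈⟨ *-cong (reflexive (≡.cong (if_then x (suc (length pre)) else 1#) test))
           (≡.subst (λ k → monomial R x (filterᵇ v (iterate suc (suc k) (length suf))) ≈ perStep E x (suc k) q suf)
             (length-∷ʳ pre p)
             (monomial-perStep x v E e (pre ∷ʳ p) q suf (≡.trans eq (≡.sym (++-assoc pre [ p ] (q ∷ suf)))) h)) ⟩
    perStep E x (suc (length pre)) p (q ∷ suf) ∎
    where
    test : v (suc (length pre)) ≡ E p q
    test = ≡.trans (h (suc (length pre))) (≡.cong₂ E
      (≡.trans (≡.cong (λ l → at l (suc (length pre))) eq) (at-middle pre p (q ∷ suf)))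
      (≡.trans (≡.cong (λ l → at l (suc (suc (length pre)))) eq) (at-next pre p q suf)))

  permWeight-split : ∀ n i p w → permWeight n i p w ≈
    perLetter (λ q w → does (¬? (q ≟ n) ×-dec ¬? (suc q ∈? w))) s i w ⊗ perStep (λ p q → does (q <? p)) t i p w
  permWeight-split n i p []      = sym (*-identityˡ 1#)
  permWeight-split n i p (q ∷ w) = trans (*-congˡ (permWeight-split n (suc i) q w)) (interchange _ _ _ _)

  invSeqWeight-split : ∀ i p e → invSeqWeight i p e ≈
    perLetter (λ x e → does (¬? (x ≟ 0) ×-dec ¬? (x ∈? e))) s i e ⊗ perStep (λ p x → does (p <? x)) t i p e
  invSeqWeight-split i p []      = sym (*-identityˡ 1#)
  invSeqWeight-split i p (x ∷ e) = trans (*-congˡ (invSeqWeight-split (suc i) x e)) (interchange _ _ _ _)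

  permWeight-monomials : ∀ n w → length w ≡ suc n → Arrangement (Interval (suc n)) w →
    permWeight (suc n) 0 0 w ≈ monomial R s (VID (suc n) w) ⊗ monomial R t (DES (suc n) w)
  permWeight-monomials n w@(q ∷ w′) len arr = trans (permWeight-split (suc n) 0 0 w) (*-cong
    (sym (begin
      monomial R s (VID (suc n) w)
        ≡⟨ ≡.cong (monomial R s) (filterᵇ-skip (vidTest w) n ≡.refl) ⟩
      monomial R s (filterᵇ (vidTest w) (iterate suc 1 (suc n)))
        ≡⟨ ≡.cong (λ k → monomial R s (filterᵇ (vidTest w) (iterate suc 1 k))) (≡.sym len) ⟩
      monomial R s (filterᵇ (vidTest w) (iterate suc 1 (length w)))
        ≈⟨ monomial-perLetter s (vidTest w) _ w [] w ≡.refl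
             (λ { pre q post eq → ≡.trans (≡.cong (λ π → vidTest π (suc (length pre))) eq)
                    (vidTest-suffix pre q post (≡.subst (Arrangement (Interval (suc n))) eq arr)) }) ⟩
      perLetter _ s 0 w ∎))
    (sym (begin
      monomial R t (DES (suc n) w)
        ≡⟨ ≡.cong (λ is → monomial R t (filterᵇ (λ i → at w (suc i) <ᵇ at w i) is)) (range≡iterate 1 n) ⟩
      monomial R t (filterᵇ (λ i → at w (suc i) <ᵇ at w i) (iterate suc 1 n))
        ≡⟨ ≡.cong (λ k → monomial R t (filterᵇ (λ i → at w (suc i) <ᵇ at w i) (iterate suc 1 k))) (≡.sym (ℕ.suc-injective len)) ⟩
      monomial R t (filterᵇ (λ i → at w (suc i) <ᵇ at w i) (iterate suc 1 (length w′)))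
        ≈⟨ monomial-perStep t _ (λ p q → does (q <? p)) w [] q w′ ≡.refl (λ _ → ≡.refl) ⟩
      perStep _ t 1 q w′
        -- The weight includes a step from a fictitious previous letter 0. No letter is below 0, so
        -- `t 0` never enters.
        ≈⟨ *-identityˡ _ ⟨
      perStep _ t 0 0 w ∎)))

  invSeqWeight-monomials : ∀ n e → length e ≡ suc n → Bounded 0 e →
    invSeqWeight 0 0 e ≈ monomial R s (DIST (suc n) e) ⊗ monomial R t (ASC (suc n) e)
  invSeqWeight-monomials n e@(.0 ∷ e′) ≡.refl (z≤n ∷ _) = trans (invSeqWeight-split 0 0 e) (*-cong
    (sym (begin
      monomial R s (DIST (suc n) e)
        ≡⟨ ≡.cong (monomial R s) (filterᵇ-skip (distTest (suc n) e) n ≡.refl) ⟩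
      monomial R s (filterᵇ (distTest (suc n) e) (iterate suc 1 (length e)))
        ≈⟨ monomial-perLetter s (distTest (suc n) e) _ e [] e ≡.refl
             (λ { pre x post eq → ≡.trans (≡.cong (λ e → distTest (length e) e (suc (length pre))) eq)
                    (distTest-suffix pre x post) }) ⟩
      perLetter _ s 0 e ∎))
    (sym (begin
      monomial R t (ASC (suc n) e)
        ≡⟨ ≡.cong (λ is → monomial R t (filterᵇ (λ i → at e i <ᵇ at e (suc i)) is)) (range≡iterate 1 n) ⟩
      monomial R t (filterᵇ (λ i → at e i <ᵇ at e (suc i)) (iterate suc 1 (length e′)))
        ≈⟨ monomial-perStep t _ (λ p q → does (p <? q)) e [] 0 e′ ≡.refl (λ _ → ≡.refl) ⟩
      perStep _ t 1 0 e′
        ≈⟨ *-identityˡ _ ⟨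
      perStep _ t 0 0 e ∎)))

  ▸-∧ : ∀ a b x → (a ▸ b ▸ x) ≡ ((a ∧ b) ▸ x)
  ▸-∧ true  b x = ≡.refl
  ▸-∧ false b x = ≡.refl

  -- Here the indicator of G is traded for the Boolean filter, which decides G.
  spec-▸ : ∀ {G a y f} b → Spec G a y → (G → y ≈ f) → (T b → G) → (G → T b) → b ▸ f ≈ a
  spec-▸ true  sp y≈f to from = sym (trans (holds sp (to tt)) (y≈f (to tt)))
  spec-▸ false sp y≈f to from = sym (fails sp from)

  ∑-avoiders : ∀ n → ∑ (avoiders (suc n)) (λ π → monomial R s (VID (suc n) π) ⊗ monomial R t (DES (suc n) π))
    ≈ pathSum (suc n) 0 1 true true
  ∑-avoiders n = begin
    ∑ (avoiders N) f
      ≈⟨ ∑-filterᵇ avoids (perms N) f ⟩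
    ∑ (perms N) (λ π → avoids π ▸ f π)
      ≈⟨ ∑-filterᵇ (isPerm N) (words N N) _ ⟩
    ∑ (words N N) (λ π → isPerm N π ▸ avoids π ▸ f π)
      ≈⟨ ∑-cong-All (All.map (λ {w} (len , box) → pointwise w len box) (words-box N N)) ⟩
    ∑ (words N N) (Ψ 0 true ((1 , n) ∷ []) true)
      ≈⟨ ∑-Ψ N N 0 true ((1 , n) ∷ []) true ((≤-refl , ≤-refl) ∷ []) ⟩
    sizesSum N 0 true (n ∷ []) true
      -- At the start all values form one run, and N has only one composition into one part, so the
      -- actual sizes already exhaust the sum over all sizes.
      ≈⟨ compositions-singleton n (λ cs → sizesSum N 0 true cs true) ⟨
    compositions 1 N (λ cs → sizesSum N 0 true cs true)
      ≈⟨ compositions-sizesSum N 0 1 true true ⟩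
    pathSum N 0 1 true true ∎
    where
    N = suc n
    f : List ℕ → Carrier
    f π = monomial R s (VID N π) ⊗ monomial R t (DES N π)
    avoids : List ℕ → Bool
    avoids π = not (contains3142 N π ∨ contains3124 N π)

    toRuns : ∀ {w} → Arrangement (Interval N) w → Arrangement (InRuns ((1 , n) ∷ [])) w
    toRuns = arrangement-map here (λ { (here v∈) → v∈ })
    fromRuns : ∀ {w} → Arrangement (InRuns ((1 , n) ∷ [])) w → Arrangement (Interval N) w
    fromRuns = arrangement-map (λ { (here v∈) → v∈ }) here

    pointwise : ∀ w → length w ≡ N → All (Interval N) w →
      isPerm N w ▸ avoids w ▸ f w ≈ Ψ 0 true ((1 , n) ∷ []) true w
    pointwise w len box = trans (reflexive (▸-∧ (isPerm N w) (avoids w) (f w)))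
      (spec-▸ (isPerm N w ∧ avoids w)
        (Ψ-spec N 0 true ((1 , n) ∷ []) true 0 w
          -- The only run reaches up to the largest value and lies above the fictitious letter 0, so
          -- both flags start as true.
          (runState ([] ∷ []) (≤-refl ∷ []) ≡.refl (≤-refl , [])))
        (λ (arr , _) → permWeight-monomials n w len (fromRuns arr))
        to from)
      where
      to : T (isPerm N w ∧ avoids w) → Good N ((1 , n) ∷ []) w
      to h = let perm , av = Equivalence.to T-∧ h
                 arr = isPerm⁻ len box perm
             in toRuns arr , avoids⇒PermAdmissible w (≡.subst (λ k → Arrangement (Interval k) w) (≡.sym len) arr)
                  (≡.subst (λ k → ¬ T (contains3142 k w ∨ contains3124 k w)) (≡.sym len) (T-not⁻ av))
      from : Good N ((1 , n) ∷ []) w → T (isPerm N w ∧ avoids w)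
      from (arr , ad) = Equivalence.from T-∧ (isPerm⁺ (fromRuns arr) ,
        T-not⁺ (≡.subst (λ k → ¬ T (contains3142 k w ∨ contains3124 k w)) len
          (PermAdmissible⇒avoids w (Arrangement.unique arr) ad)))

  ∑-invAvoiders : ∀ n → ∑ (invAvoiders (suc n)) (λ e → monomial R s (DIST (suc n) e) ⊗ monomial R t (ASC (suc n) e))
    ≈ pathSum (suc n) 0 1 true true
  ∑-invAvoiders n = begin
    ∑ (invAvoiders N) f
      ≈⟨ ∑-filterᵇ avoids (invSeqs N) f ⟩
    ∑ (invSeqs N) (λ e → avoids e ▸ f e)
      ≈⟨ ∑-invSeqs N _ ⟩
    ∑ (suffixes 0 N) (λ e → avoids e ▸ f e)
      ≈⟨ ∑-cong-All (All.zipWith (λ {e} (len , bd) → pointwise e len bd) (suffixes-length 0 N , suffixes-Bounded 0 N)) ⟩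
    ∑ (suffixes 0 N) (Φ 0 true (0 ∷ []) true)
      ≈⟨ ∑-Φ N 0 true (0 ∷ []) true (z≤n ∷ []) ⟩
    pathSum N 0 1 true true ∎
    where
    N = suc n
    f : List ℕ → Carrier
    f e = monomial R s (DIST N e) ⊗ monomial R t (ASC N e)
    avoids : List ℕ → Bool
    avoids e = not (containsGeNeGe N e)

    pointwise : ∀ e → length e ≡ N → Bounded 0 e → avoids e ▸ f e ≈ Φ 0 true (0 ∷ []) true e
    pointwise e@(.0 ∷ _) len bd@(z≤n ∷ _) = spec-▸ (avoids e)
      -- The first entry is forced to be 0, so 0 is the only label at the start; it does not exceed
      -- the fictitious previous letter 0.
      (Φ-spec 0 true (0 ∷ []) true 0 e ([] ∷ []) (z≤n ∷ []) ≡.refl (z≤n , []) bd)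
      (λ _ → invSeqWeight-monomials n e len bd)
      (λ av → ((λ { z≤n _ → here ≡.refl }) , (λ { (here ≡.refl) → here ≡.refl })) ,
        avoids⇒Admissible e (≡.subst (λ k → ¬ T (containsGeNeGe k e)) (≡.sym len) (T-not⁻ av)))
      (λ (_ , ad) → T-not⁺ (≡.subst (λ k → ¬ T (containsGeNeGe k e)) len (Admissible⇒avoids e ad)))

theorem3p7 : {c ℓ : Level} (R : CommutativeSemiring c ℓ) (s t : ℕ → CommutativeSemiring.Carrier R) (n : ℕ) → 1 ≤ n →
    CommutativeSemiring._≈_ R
    (Σ[_] R (avoiders n) (λ π → CommutativeSemiring._*_ R (monomial R s (VID n π)) (monomial R t (DES n π))))
    (Σ[_] R (invAvoiders n) (λ e → CommutativeSemiring._*_ R (monomial R s (DIST n e)) (monomial R t (ASC n e))))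
theorem3p7 R s t (suc n) (s≤s z≤n) =
  CommutativeSemiring.trans R (∑-avoiders n) (CommutativeSemiring.sym R (∑-invAvoiders n))
  where open Main R s t
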